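{- Let $D$ be a northwest diagram and $r$ a row index such that every cell of $D$ in row $r$ has a cell of $D$ directly below it in row $r+1$. Then for every $T\in\mathrm{KD}(D)$ with $f_r(T)\neq 0$ we have $f_r(T)\in\mathrm{KD}(D)$. In particular $\mathfrak{D}_r(\mathrm{KD}(D))=\mathrm{KD}(D)$.
   Context: A diagram is a finite set of cells $(i,j)\in\mathbb{Z}_{>0}^2$ ($i$ row, $j$ column), rows numbered top to bottom. $D$ is northwest if whenever $(j,k),(i,l)\in D$ with $i<j$, $k<l$, then $(i,k)\in D$. A Kohnert move selects the rightmost cell of some row and moves it up (toward row 1) within its column to the first empty position above it, jumping over occupied positions, if one exists; $\mathrm{KD}(D)$ is the set of diagrams reachable from $D$ by sequences of Kohnert moves (including $D$). Kohnert crystal operators: for a diagram $T$ and $i\ge1$, $i$-pair cells of $T$ in rows $i,i+1$ iteratively by pairing an unpaired cell in row $i+1$ with an unpaired cell in row $i$ weakly to its left whenever all cells in rows $i,i+1$ lying (in columns) between them are already $i$-paired. The raising operator $e_i(T)$ is $0$ if all cells of row $i+1$ are $i$-paired, and otherwise moves the rightmost unpaired cell of row $i+1$ to row $i$ (same column). The lowering operator $f_i(T)$ is $0$ if all cells of row $i$ are $i$-paired, and otherwise moves the leftmost unpaired cell of row $i$ to row $i+1$. For a set $X$ of diagrams, $\mathfrak{D}_i(X)=\{U \text{ a diagram}: e_i^k(U)\in X\text{ for some }k\ge0\}$. -}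

module Defs where

open import Data.Nat using (ℕ; zero; suc; _<_; _≤_; _⊔_; _≡ᵇ_; _≟_)
open import Data.Bool using (Bool; true; false; if_then_else_; _∧_; not)
open import Data.Product using (_×_; _,_; Σ; ∃; ∃-syntax; proj₁; proj₂)
open import Data.Sum using (_⊎_)
open import Data.Bool.ListAction using (any)
open import Data.List using (List; []; _∷_; upTo; foldl; foldr; filter; last; map)
open import Data.List.Membership.Propositional using (_∈_; _∉_)
open import Data.Maybe using (Maybe; just; nothing; _>>=_)
open import Relation.Binary.PropositionalEquality using (_≡_; _≢_)
open import Relation.Binary.Construct.Closure.ReflexiveTransitive using (Star)
open import Relation.Nullary using (¬_; ¬?; _×-dec_)
open import Relation.Nullary.Decidable using (does)
open import Function.Bundles using (_⇔_)

-- Cells are (row , column); rows numbered top to bottom.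
-- CONVENTION: indices are 0-based (row 0 is the top row), i.e. the paper's
-- cell (i , j) ∈ ℤ>0² is represented by (i - 1 , j - 1).
Cell : Set
Cell = ℕ × ℕ

-- A diagram is a finite set of cells, represented by a list; only
-- membership matters (diagrams are compared as sets, see _≃_).
Diagram : Set
Diagram = List Cell

_≃_ : Diagram → Diagram → Set
D ≃ E = ∀ x → (x ∈ D) ⇔ (x ∈ E)

Northwest : Diagram → Set
Northwest D = ∀ i j k l → (j , k) ∈ D → (i , l) ∈ D → i < j → k < l → (i , k) ∈ D

KohnertMove : Diagram → Diagram → Set
KohnertMove D E =
  Σ ℕ λ r → Σ ℕ λ c → Σ ℕ λ r' →
    ((r , c) ∈ D)
  × (∀ c' → (r , c') ∈ D → c' ≤ c)
  × (r' < r)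
  × ((r' , c) ∉ D)
  × (∀ s → r' < s → s < r → (s , c) ∈ D)
  × (∀ x → (x ∈ E) ⇔ (((x ∈ D) × (x ≢ (r , c))) ⊎ (x ≡ (r' , c))))

KD : Diagram → Diagram → Set
KD D T = ∃[ T' ] (Star KohnertMove D T' × (T' ≃ T))

hasCell : Diagram → ℕ → ℕ → Bool
hasCell D i c = any (λ x → (proj₁ x ≡ᵇ i) ∧ (proj₂ x ≡ᵇ c)) D

colBound : Diagram → ℕ
colBound D = suc (foldr (λ x m → proj₂ x ⊔ m) 0 D)

-- i-pairing, by scanning columns from left to right.  The state is
-- (columns of currently unpaired cells of row i, most recent first ,
--  columns of unpaired cells of row i+1, most recent first).
-- In a column, the row-i cell is seen before the row-(i+1) cell ("weakly
-- to its left").  A row-(i+1) cell pairs with the nearest unpaired row-i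
-- cell weakly to its left; all cells in between are then already paired,
-- which is exactly the paper's iterative pairing rule.
pairStep : Diagram → ℕ → List ℕ × List ℕ → ℕ → List ℕ × List ℕ
pairStep D i (st , lo) c with (if hasCell D i c then c ∷ st else st)
... | st1 with hasCell D (suc i) c
...   | false = st1 , lo
...   | true with st1
...     | []       = [] , c ∷ lo
...     | (_ ∷ st2) = st2 , lo

pairing : Diagram → ℕ → List ℕ × List ℕ
pairing D i = foldl (pairStep D i) ([] , []) (upTo (colBound D))

-- columns of the unpaired cells of row i (rightmost first)
unpairedUpper : Diagram → ℕ → List ℕ
unpairedUpper D i = proj₁ (pairing D i)

-- columns of the unpaired cells of row i+1 (rightmost first)
unpairedLower : Diagram → ℕ → List ℕ
unpairedLower D i = proj₂ (pairing D i)

moveCell : Diagram → ℕ → ℕ → ℕ → Diagram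
moveCell D a b c =
  (b , c) ∷ filter (λ x → ¬? ((proj₁ x ≟ a) ×-dec (proj₂ x ≟ c))) D

-- raising operator e_i (nothing represents 0)
raise : ℕ → Diagram → Maybe Diagram
raise i T with unpairedLower T i
... | []      = nothing
... | (c ∷ _) = just (moveCell T (suc i) i c)

-- lowering operator f_i (nothing represents 0)
lower : ℕ → Diagram → Maybe Diagram
lower i T with last (unpairedUpper T i)
... | nothing = nothing
... | just c  = just (moveCell T i (suc i) c)

raiseIter : ℕ → ℕ → Diagram → Maybe Diagram
raiseIter i zero    U = just U
raiseIter i (suc k) U = raise i U >>= raiseIter i k

𝔇 : ℕ → (Diagram → Set) → Diagram → Set
𝔇 i X U = ∃[ k ] ∃[ V ] ((raiseIter i k U ≡ just V) × X V)

{-# OPTIONS --safe #-}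
module Submission where

-- Give every cell of D its row as a label, except that rows r and r + 1 share
-- the label r.  A diagram T is read column by column, keeping a state that tells
-- which label sits in which row: at each column the state may first be lowered
-- in Bruhat order, and then the rows holding a label of that column of D must be
-- exactly the cells of that column of T.  Labels that occur in no later column
-- are forgotten.  Call T admissible if such a chain of states exists, the first
-- one having no label below its own row.
--
-- * Admissible diagrams are closed under Kohnert moves: kick the label of the
--   departing row upwards in the current state and in all later ones, where that
--   row is not occupied.  As D is admissible, so is every member of KD(D).
-- * They are closed under f_r: if every cell of row r to the left of column c is
--   paired, the state before column c can be chosen with the label of row r + 1
--   not exceeding that of row r, so exchanging these two labels is still a lowering.
-- * Admissible diagrams lie in KD(D): any row that is unused in the state bounding
--   the chain can be emptied by reverse Kohnert moves (clear), and then a label of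
--   the first column can be put back one step towards its place in D (climb).

open import Defs
open import Data.Bool using (Bool; true; false; T; if_then_else_; _∧_)
open import Data.List using (List; []; _∷_; upTo; foldl; last)
open import Data.List.Membership.Propositional using (_∈_; _∉_; find; lose)
open import Data.List.Membership.Propositional.Properties using (∈-filter⁺; ∈-filter⁻)
open import Data.List.Properties using (upTo-∷ʳ; foldl-∷ʳ)
open import Data.List.Relation.Unary.Any using (Any; here; there; any?)
open import Data.Maybe using (just)
open import Data.Nat
open import Data.Nat.Properties
open import Data.Nat.Tactic.RingSolver using (solve-∀)
open import Data.Product using (_×_; _,_; ∃-syntax; proj₁; proj₂)
open import Data.Product.Properties using (,-injective)
open import Data.Sum using (_⊎_; inj₁; inj₂)
open import Data.Unit using (⊤; tt)
open import Function using (_∘_)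
open import Function.Bundles using (_⇔_; mk⇔; Equivalence)
open import Relation.Binary.Construct.Closure.ReflexiveTransitive using (Star; ε; _◅_)
open import Relation.Binary.Definitions using (tri<; tri≈; tri>)
open import Relation.Binary.PropositionalEquality
open import Relation.Nullary using (¬_; ¬?; Dec; yes; no; contradiction; _×-dec_)
open import Relation.Nullary.Decidable using (map′)

-- Comparisons as Booleans, and bounded search

true≢false : true ≢ false
true≢false ()

<ᵇ-true : ∀ {m n} → m < n → (m <ᵇ n) ≡ true
<ᵇ-true {m} {n} m<n with m <ᵇ n | <⇒<ᵇ m<n
... | true | _ = refl

<ᵇ-false : ∀ {m n} → n ≤ m → (m <ᵇ n) ≡ false
<ᵇ-false {m} {n} n≤m with m <ᵇ n in eq
... | false = refl
... | true  = contradiction (<ᵇ⇒< m n (subst T (sym eq) tt)) (≤⇒≯ n≤m)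

true-<ᵇ : ∀ {m n} → (m <ᵇ n) ≡ true → m < n
true-<ᵇ {m} {n} eq = <ᵇ⇒< m n (subst T (sym eq) tt)

false-<ᵇ : ∀ {m n} → (m <ᵇ n) ≡ false → n ≤ m
false-<ᵇ {m} {n} eq = ≮⇒≥ λ m<n → true≢false (trans (sym (<ᵇ-true m<n)) eq)

≡ᵇ-refl : ∀ n → (n ≡ᵇ n) ≡ true
≡ᵇ-refl zero    = refl
≡ᵇ-refl (suc n) = ≡ᵇ-refl n

≡ᵇ-false : ∀ {m n} → m ≢ n → (m ≡ᵇ n) ≡ false
≡ᵇ-false {m} {n} m≢n with m ≡ᵇ n in eq
... | false = refl
... | true  = contradiction (≡ᵇ⇒≡ m n (subst T (sym eq) tt)) m≢n

∸-suc : ∀ {m n} → m < n → n ∸ m ≡ suc (n ∸ suc m)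
∸-suc {m} {suc n} (s≤s m≤n) = +-∸-assoc 1 m≤n

true-≡ᵇ : ∀ {m n} → (m ≡ᵇ n) ≡ true → m ≡ n
true-≡ᵇ {m} {n} e = ≡ᵇ⇒≡ m n (subst T (sym e) tt)

bit : Bool → ℕ
bit true  = 1
bit false = 0

bit≤1 : ∀ b → bit b ≤ 1
bit≤1 true  = ≤-refl
bit≤1 false = z≤n

bit-mono : ∀ {a b} → (a ≡ true → b ≡ true) → bit a ≤ bit b
bit-mono {true}  {b} h rewrite h refl = ≤-refl
bit-mono {false} h = z≤n

bit-split : ∀ x p → bit (x <ᵇ suc p) ≡ bit (x <ᵇ p) + bit (x ≡ᵇ p)
bit-split x p with <-cmp x p
... | tri< x<p x≢p _ rewrite <ᵇ-true x<p | <ᵇ-true (m<n⇒m<1+n x<p) | ≡ᵇ-false x≢p = refl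
... | tri≈ _ refl _ rewrite <ᵇ-false (≤-refl {x}) | <ᵇ-true (n<1+n x) | ≡ᵇ-refl x = refl
... | tri> _ x≢p p<x rewrite <ᵇ-false (<⇒≤ p<x) | <ᵇ-false p<x | ≡ᵇ-false x≢p = refl

count : (ℕ → Bool) → ℕ → ℕ → ℕ
count f v zero    = 0
count f v (suc k) = bit (f v) + count f (suc v) k

firstAbove : ∀ {P : ℕ → Set} → (∀ x → Dec (P x)) → ∀ {a e} → a < e → P e
           → ∃[ i ] (a < i × i ≤ e × P i × (∀ x → a < x → x < i → ¬ P x))
firstAbove {P} P? {a} {e} a<e Pe = go (e ∸ suc a) a a<e (m∸n+n≡m a<e)
  where
  go : ∀ k a → a < e → k + suc a ≡ e → ∃[ i ] (a < i × i ≤ e × P i × (∀ x → a < x → x < i → ¬ P x))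
  go k a a<e eq with P? (suc a)
  ... | yes p = suc a , n<1+n a , a<e , p , λ x a<x x≤a → contradiction a<x (≤⇒≯ (≤-pred x≤a))
  go zero a a<e refl | no ¬p = contradiction Pe ¬p
  go (suc k) a a<e eq | no ¬p with go k (suc a) (subst (suc (suc a) ≤_) (trans (+-suc k (suc a)) eq) (m≤n+m (suc (suc a)) k))
                                 (trans (+-suc k (suc a)) eq)
  ... | i , a<i , i≤e , Pi , none = i , <⇒≤ a<i , i≤e , Pi , before
    where
    before : ∀ x → a < x → x < i → ¬ P x
    before x a<x x<i with m≤n⇒m<n∨m≡n a<x
    ... | inj₁ a+1<x = none x a+1<x x<i
    ... | inj₂ refl  = ¬p

lastBelow : ∀ {P : ℕ → Set} → (∀ x → Dec (P x)) → ∀ k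
          → (∃[ b ] (b < k × P b × (∀ x → b < x → x < k → ¬ P x))) ⊎ (∀ x → x < k → ¬ P x)
lastBelow P? zero = inj₂ λ _ ()
lastBelow {P} P? (suc k) with P? k
... | yes p = inj₁ (k , n<1+n k , p , λ x k<x x≤k → contradiction k<x (≤⇒≯ (≤-pred x≤k)))
... | no ¬p = extend (lastBelow P? k)
  where
  at-or-below : ∀ x → x < suc k → (x < k → ¬ P x) → ¬ P x
  at-or-below x x≤k h with m≤n⇒m<n∨m≡n (≤-pred x≤k)
  ... | inj₁ x<k  = h x<k
  ... | inj₂ refl = ¬p
  extend : _ → (∃[ b ] (b < suc k × P b × (∀ x → b < x → x < suc k → ¬ P x))) ⊎ (∀ x → x < suc k → ¬ P x)
  extend (inj₁ (b , b<k , Pb , none)) = inj₁ (b , m<n⇒m<1+n b<k , Pb , λ x b<x x≤k → at-or-below x x≤k (none x b<x))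
  extend (inj₂ none)                  = inj₂ λ x x≤k → at-or-below x x≤k (none x)

-- Counting the rows from a given row down

module Rows (B : ℕ) where

  -- the number of rows v ≤ x < B satisfying f
  # : (ℕ → Bool) → ℕ → ℕ
  # f v = count f v (B ∸ v)

  #-step : ∀ f {v} → v < B → # f v ≡ bit (f v) + # f (suc v)
  #-step f {v} v<B = cong (count f v) (∸-suc v<B)

  #-end : ∀ f {v} → B ≤ v → # f v ≡ 0
  #-end f {v} B≤v rewrite m≤n⇒m∸n≡0 B≤v = refl

  -- Suffix counts are determined by what lies below, so facts about them are proved from row `B` up
  -- to row 0.
  downward : (P : ℕ → Set) → (∀ v → B ≤ v → P v) → (∀ v → v < B → P (suc v) → P v) → ∀ v → P v
  downward P end step v = go B v (m≤m+n B v)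
    where
    go : ∀ k v → B ≤ k + v → P v
    go zero    v h = end v h
    go (suc k) v h with v <? B
    ... | yes v<B = step v v<B (go k (suc v) (subst (B ≤_) (sym (+-suc k v)) h))
    ... | no  v≮B = end v (≮⇒≥ v≮B)

  #-mono : ∀ f g v → (∀ x → v ≤ x → x < B → f x ≡ true → g x ≡ true) → # f v ≤ # g v
  #-mono f g = downward _
    (λ v B≤v _ → ≤-reflexive (trans (#-end f B≤v) (sym (#-end g B≤v))))
    (λ v v<B ih h → subst₂ _≤_ (sym (#-step f v<B)) (sym (#-step g v<B))
      (+-mono-≤ (bit-mono (h v ≤-refl v<B)) (ih λ x v<x → h x (<⇒≤ v<x))))

  #-cong : ∀ f g v → (∀ x → v ≤ x → x < B → f x ≡ g x) → # f v ≡ # g v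
  #-cong f g v h = ≤-antisym
    (#-mono f g v λ x v≤x x<B e → trans (sym (h x v≤x x<B)) e)
    (#-mono g f v λ x v≤x x<B e → trans (h x v≤x x<B) e)

  #-suc≤ : ∀ f v → # f (suc v) ≤ # f v
  #-suc≤ f v with v <? B
  ... | yes v<B = subst (# f (suc v) ≤_) (sym (#-step f v<B)) (m≤n+m _ _)
  ... | no  v≮B = ≤-trans (≤-reflexive (#-end f (m≤n⇒m≤1+n (≮⇒≥ v≮B)))) z≤n

  #-antitone : ∀ f {v w} → v ≤ w → # f w ≤ # f v
  #-antitone f {v} v≤w = go (≤⇒≤′ v≤w)
    where
    go : ∀ {w} → v ≤′ w → # f w ≤ # f v
    go ≤′-refl     = ≤-refl
    go (≤′-step {w} h) = ≤-trans (#-suc≤ f w) (go h)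

  #-≤-gap : ∀ f k v → # f v ≤ k + # f (k + v)
  #-≤-gap f zero    v = ≤-refl
  #-≤-gap f (suc k) v with v <? B
  ... | no  v≮B = ≤-trans (≤-reflexive (#-end f (≮⇒≥ v≮B))) z≤n
  ... | yes v<B = subst₂ _≤_ (sym (#-step f v<B)) (cong (λ z → suc k + # f z) (+-suc k v))
                    (+-mono-≤ (bit≤1 (f v)) (#-≤-gap f k (suc v)))

  #-full : ∀ f k v → k + v ≤ B → (∀ x → v ≤ x → x < k + v → f x ≡ true) → # f v ≡ k + # f (k + v)
  #-full f zero    v _ _ = refl
  #-full f (suc k) v h t = begin
    # f v                        ≡⟨ #-step f (≤-trans (m≤n+m (suc v) k) (subst (_≤ B) (sym (+-suc k v)) h)) ⟩
    bit (f v) + # f (suc v)      ≡⟨ cong (λ z → bit z + # f (suc v)) (t v ≤-refl (s≤s (m≤n+m v k))) ⟩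
    suc (# f (suc v))            ≡⟨ cong suc (#-full f k (suc v) (subst (_≤ B) (sym (+-suc k v)) h)
                                       λ x v<x x< → t x (<⇒≤ v<x) (subst (x <_) (+-suc k v) x<)) ⟩
    suc (k + # f (k + suc v))    ≡⟨ cong (λ z → suc (k + # f z)) (+-suc k v) ⟩
    suc k + # f (suc k + v)      ∎
    where open ≡-Reasoning

  #-≤-gap′ : ∀ f {v w} → v ≤ w → # f v ≤ (w ∸ v) + # f w
  #-≤-gap′ f {v} {w} v≤w = subst (λ z → # f v ≤ (w ∸ v) + # f z) (m∸n+n≡m v≤w) (#-≤-gap f (w ∸ v) v)

  #-full′ : ∀ f {v w} → v ≤ w → w ≤ B → (∀ x → v ≤ x → x < w → f x ≡ true) → # f v ≡ (w ∸ v) + # f w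
  #-full′ f {v} {w} v≤w w≤B t = trans
    (#-full f (w ∸ v) v (subst (_≤ B) (sym e) w≤B) (λ x v≤x x< → t x v≤x (subst (x <_) e x<)))
    (cong (λ z → (w ∸ v) + # f z) e)
    where e = m∸n+n≡m v≤w

  -- A row between `v` and `a` that fails `f` lowers by one the trivial bound `suc a ∸ v` on the
  -- contribution of these rows. This is the unit gained in `kick-mono`.
  #-hole : ∀ f {v i a} → v ≤ i → i ≤ a → f i ≡ false → # f v ≤ (a ∸ v) + # f (suc a)
  #-hole f {v} {i} {a} v≤i i≤a fi = begin
    # f v                               ≤⟨ #-≤-gap′ f v≤i ⟩
    (i ∸ v) + # f i                     ≤⟨ +-monoʳ-≤ (i ∸ v) skip ⟩
    (i ∸ v) + # f (suc i)               ≤⟨ +-monoʳ-≤ (i ∸ v) (#-≤-gap′ f (s≤s i≤a)) ⟩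
    (i ∸ v) + ((a ∸ i) + # f (suc a))   ≡⟨ sym (+-assoc (i ∸ v) (a ∸ i) _) ⟩
    (i ∸ v) + (a ∸ i) + # f (suc a)     ≡⟨ cong (_+ # f (suc a)) (trans (+-comm (i ∸ v) (a ∸ i)) (m∸n+n∸o≡m∸o i≤a v≤i)) ⟩
    (a ∸ v) + # f (suc a)               ∎
    where
    open ≤-Reasoning
    m∸n+n∸o≡m∸o : ∀ {m n o} → n ≤ m → o ≤ n → (m ∸ n) + (n ∸ o) ≡ m ∸ o
    m∸n+n∸o≡m∸o {m} {n} {o} n≤m o≤n = trans (sym (+-∸-assoc (m ∸ n) o≤n)) (cong (_∸ o) (m∸n+n≡m n≤m))
    skip : # f i ≤ # f (suc i)
    skip with i <? B
    ... | yes i<B = ≤-reflexive (trans (#-step f i<B) (cong (λ z → bit z + # f (suc i)) fi))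
    ... | no  i≮B = ≤-trans (≤-reflexive (#-end f (≮⇒≥ i≮B))) z≤n

  #-witness : ∀ f g v → # f v < # g v → ∃[ x ] (v ≤ x × x < B × f x ≡ false × g x ≡ true)
  #-witness f g = downward _
    (λ v B≤v lt → contradiction (subst (# f v <_) (#-end g B≤v) lt) λ ())
    step
    where
    step : ∀ v → v < B → (# f (suc v) < # g (suc v) → ∃[ x ] (suc v ≤ x × x < B × f x ≡ false × g x ≡ true))
         → # f v < # g v → ∃[ x ] (v ≤ x × x < B × f x ≡ false × g x ≡ true)
    step v v<B ih lt with f v in fv | g v in gv | subst₂ _<_ (#-step f v<B) (#-step g v<B) lt
    ... | false | true  | _ = v , ≤-refl , v<B , fv , gv
    ... | false | false | l = let x , a , b = ih l in x , <⇒≤ a , b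
    ... | true  | true  | l = let x , a , b = ih (≤-pred l) in x , <⇒≤ a , b
    ... | true  | false | l = let x , a , b = ih (<-trans (n<1+n _) l) in x , <⇒≤ a , b

  #-strict : ∀ f g {y} → (∀ x → f x ≡ true → g x ≡ true) → y < B → f y ≡ false → g y ≡ true
           → ∀ v → v ≤ y → # f v < # g v
  #-strict f g {y} h y<B fy gy = downward _
    (λ v B≤v v≤y → contradiction (≤-<-trans v≤y y<B) (≤⇒≯ B≤v))
    step
    where
    step : ∀ v → v < B → (suc v ≤ y → # f (suc v) < # g (suc v)) → v ≤ y → # f v < # g v
    step v v<B ih v≤y with m≤n⇒m<n∨m≡n v≤y
    ... | inj₁ v<y = subst₂ _<_ (sym (#-step f v<B)) (sym (#-step g v<B)) (+-mono-≤-< (bit-mono (h v)) (ih v<y))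
    ... | inj₂ refl = subst₂ _<_ (sym (trans (#-step f v<B) (cong (λ z → bit z + # f (suc v)) fy)))
                                 (sym (trans (#-step g v<B) (cong (λ z → bit z + # g (suc v)) gy)))
                                 (s≤s (#-mono f g (suc v) λ x _ _ → h x))

  count-none : ∀ v k → count (λ _ → false) v k ≡ 0
  count-none v zero    = refl
  count-none v (suc k) = count-none (suc v) k

  #-skip : ∀ f {v w} → v ≤ w → (∀ x → v ≤ x → x < w → f x ≡ false) → # f v ≡ # f w
  #-skip f v≤w none = go (≤⇒≤′ v≤w) none
    where
    go : ∀ {v w} → v ≤′ w → (∀ x → v ≤ x → x < w → f x ≡ false) → # f v ≡ # f w
    go ≤′-refl _ = refl
    go (≤′-step {w} h) none = trans (go h λ x v≤x x<w → none x v≤x (m<n⇒m<1+n x<w)) atEnd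
      where
      atEnd : # f w ≡ # f (suc w)
      atEnd with w <? B
      ... | yes w<B = trans (#-step f w<B) (cong (λ b → bit b + # f (suc w)) (none w (≤′⇒≤ h) (n<1+n w)))
      ... | no w≮B  = trans (#-end f (≮⇒≥ w≮B)) (sym (#-end f (m≤n⇒m≤1+n (≮⇒≥ w≮B))))

  #≤B : ∀ f v → # f v ≤ B
  #≤B f v with v ≤? B
  ... | yes v≤B = begin
    # f v               ≤⟨ #-≤-gap′ f v≤B ⟩
    (B ∸ v) + # f B     ≡⟨ cong ((B ∸ v) +_) (#-end f ≤-refl) ⟩
    (B ∸ v) + 0         ≡⟨ +-identityʳ _ ⟩
    B ∸ v               ≤⟨ m∸n≤m B v ⟩
    B                   ∎
    where open ≤-Reasoning
  ... | no v≰B = ≤-trans (≤-reflexive (#-end f (<⇒≤ (≰⇒> v≰B)))) z≤n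

  -- Its growth shows that the construction of climb terminates.
  area : (ℕ → Bool) → ℕ → ℕ
  area f zero    = 0
  area f (suc k) = # f k + area f k

  area≤ : ∀ f k → area f k ≤ k * B
  area≤ f zero    = z≤n
  area≤ f (suc k) = +-mono-≤ (#≤B f k) (area≤ f k)

  area-mono : ∀ {f g} k → (∀ v → # f v ≤ # g v) → area f k ≤ area g k
  area-mono zero    h = z≤n
  area-mono (suc k) h = +-mono-≤ (h k) (area-mono k h)

  area-strict : ∀ {f g y} k → (∀ v → # f v ≤ # g v) → y < k → # f y < # g y → area f k < area g k
  area-strict (suc k) h y≤k lt with m≤n⇒m<n∨m≡n (≤-pred y≤k)
  ... | inj₁ y<k  = +-mono-≤-< (h k) (area-strict k h y<k lt)
  ... | inj₂ refl = +-mono-<-≤ lt (area-mono k h)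

  -- The exchange is felt only by suffixes starting strictly below `a` and not below `e`, which
  -- trade the bit of `e` for that of `a`. The bits stand on both sides so that no truncated
  -- subtraction occurs.
  module Transposed (f f′ : ℕ → Bool) {a e : ℕ} (a<e : a < e) (e<B : e < B)
    (f′a : f′ a ≡ f e) (f′e : f′ e ≡ f a) (f′o : ∀ x → x ≢ a → x ≢ e → f′ x ≡ f x) where

    above : ∀ v → e < v → # f′ v ≡ # f v
    above v e<v = #-cong f′ f v λ x v≤x _ →
      f′o x (λ { refl → <-asym a<e (<-≤-trans e<v v≤x) }) (λ { refl → <-irrefl refl (<-≤-trans e<v v≤x) })

    between : ∀ v → a < v → v ≤ e → # f′ v + bit (f e) ≡ # f v + bit (f a)
    between = downward _
      (λ v B≤v _ v≤e → contradiction (≤-<-trans v≤e e<B) (≤⇒≯ B≤v)) step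
      where
      swap₃ : ∀ x y z → x + y + z ≡ z + y + x
      swap₃ = solve-∀
      step : ∀ v → v < B → (a < suc v → suc v ≤ e → # f′ (suc v) + bit (f e) ≡ # f (suc v) + bit (f a))
           → a < v → v ≤ e → # f′ v + bit (f e) ≡ # f v + bit (f a)
      step v v<B ih a<v v≤e rewrite #-step f′ v<B | #-step f v<B with m≤n⇒m<n∨m≡n v≤e
      ... | inj₂ refl rewrite f′e | above (suc v) (n<1+n v) = swap₃ (bit (f a)) (# f (suc v)) (bit (f v))
      ... | inj₁ v<e rewrite f′o v (>⇒≢ a<v) (<⇒≢ v<e)
                           | +-assoc (bit (f v)) (# f′ (suc v)) (bit (f e))
                           | +-assoc (bit (f v)) (# f (suc v)) (bit (f a))
                           = cong (bit (f v) +_) (ih (m<n⇒m<1+n a<v) v<e)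

    below : ∀ v → v ≤ a → # f′ v ≡ # f v
    below = downward _
      (λ v B≤v v≤a → contradiction (≤-<-trans v≤a (<-trans a<e e<B)) (≤⇒≯ B≤v)) step
      where
      step : ∀ v → v < B → (suc v ≤ a → # f′ (suc v) ≡ # f (suc v)) → v ≤ a → # f′ v ≡ # f v
      step v v<B ih v≤a rewrite #-step f′ v<B | #-step f v<B with m≤n⇒m<n∨m≡n v≤a
      ... | inj₂ refl rewrite f′a = trans (+-comm (bit (f e)) _)
              (trans (between (suc v) (n<1+n v) a<e) (+-comm _ (bit (f v))))
      ... | inj₁ v<a rewrite f′o v (<⇒≢ v<a) (<⇒≢ (<-trans v<a a<e)) = cong (bit (f v) +_) (ih v<a)

-- Bruhat order on states

-- The label carried by each row; a value ≥ B (the bound on rows and labels fixed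
-- in States) means that the row is unused.
State : Set
State = ℕ → ℕ

uses : State → ℕ → ℕ → Bool
uses u p v = u v <ᵇ p

exchange : State → ℕ → ℕ → State
exchange u a e v = if v ≡ᵇ a then u e else if v ≡ᵇ e then u a else u v

exchange-fst : ∀ u a e → exchange u a e a ≡ u e
exchange-fst u a e rewrite ≡ᵇ-refl a = refl

exchange-snd : ∀ u {a e} → a < e → exchange u a e e ≡ u a
exchange-snd u {a} {e} a<e rewrite ≡ᵇ-false (>⇒≢ a<e) | ≡ᵇ-refl e = refl

exchange-other : ∀ u a e x → x ≢ a → x ≢ e → exchange u a e x ≡ u x
exchange-other u a e x x≢a x≢e rewrite ≡ᵇ-false x≢a | ≡ᵇ-false x≢e = refl

-- A Demazure step: the exchange is made only when it moves the state up in the order `⊑`. Either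
-- way row `suc r` ends with a label not exceeding that of row `r`.
sortAt : ℕ → State → State
sortAt r u = if u r <ᵇ u (suc r) then exchange u r (suc r) else u

topOf : State → ℕ → ℕ → ℕ
topOf u v zero    = u v
topOf u v (suc k) = u v ⊔ topOf u (suc v) k

maxTo : ℕ → State → ℕ → ℕ
maxTo a u v = topOf u v (a ∸ v)

maxTo-end : ∀ a u → maxTo a u a ≡ u a
maxTo-end a u rewrite n∸n≡0 a = refl

maxTo-step : ∀ {a v} u → v < a → maxTo a u v ≡ u v ⊔ maxTo a u (suc v)
maxTo-step {a} {v} u v<a = cong (topOf u v) (∸-suc v<a)

topOf-attained : ∀ u v k → ∃[ i ] (v ≤ i × i ≤ k + v × topOf u v k ≡ u i)
topOf-attained u v zero = v , ≤-refl , ≤-refl , refl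
topOf-attained u v (suc k) with ⊔-sel (u v) (topOf u (suc v) k) | topOf-attained u (suc v) k
... | inj₁ e | _ = v , ≤-refl , m≤n+m v (suc k) , e
... | inj₂ e | i , v<i , i≤ , e′ = i , <⇒≤ v<i , subst (i ≤_) (+-suc k v) i≤ , trans e e′

topOf-upper : ∀ u v k i → v ≤ i → i ≤ k + v → u i ≤ topOf u v k
topOf-upper u v zero i v≤i i≤v rewrite ≤-antisym v≤i i≤v = ≤-refl
topOf-upper u v (suc k) i v≤i i≤ with m≤n⇒m<n∨m≡n v≤i
... | inj₂ refl = m≤m⊔n (u v) _
... | inj₁ v<i  = ≤-trans (topOf-upper u (suc v) k i v<i (subst (i ≤_) (sym (+-suc k v)) i≤)) (m≤n⊔m (u v) _)

maxTo-attained : ∀ a u v → v ≤ a → ∃[ i ] (v ≤ i × i ≤ a × maxTo a u v ≡ u i)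
maxTo-attained a u v v≤a with topOf-attained u v (a ∸ v)
... | i , v≤i , i≤ , e = i , v≤i , subst (i ≤_) (m∸n+n≡m v≤a) i≤ , e

maxTo-upper : ∀ a u v i → v ≤ i → i ≤ a → u i ≤ maxTo a u v
maxTo-upper a u v i v≤i i≤a = topOf-upper u v (a ∸ v) i v≤i (subst (i ≤_) (sym (m∸n+n≡m (≤-trans v≤i i≤a))) i≤a)

-- Insertion of the label of row a into the rows above it, from bottom to top:
-- each row keeps the smaller label and passes on the larger one, and row a
-- receives the label passed on by row 0.
kick : ℕ → State → State
kick a u v = if v <ᵇ a then maxTo a u (suc v) ⊓ u v else if v ≡ᵇ a then maxTo a u 0 else u v

kick-above : ∀ {a v} u → v < a → kick a u v ≡ maxTo a u (suc v) ⊓ u v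
kick-above u v<a rewrite <ᵇ-true v<a = refl

kick-at : ∀ a u → kick a u a ≡ maxTo a u 0
kick-at a u rewrite <ᵇ-false (≤-refl {a}) | ≡ᵇ-refl a = refl

kick-below : ∀ {a v} u → a < v → kick a u v ≡ u v
kick-below u a<v rewrite <ᵇ-false (<⇒≤ a<v) | ≡ᵇ-false (>⇒≢ a<v) = refl

bit-min-max : ∀ x y p → bit (x ⊓ y <ᵇ p) + bit (y ⊔ x <ᵇ p) ≡ bit (x <ᵇ p) + bit (y <ᵇ p)
bit-min-max x y p with ≤-total x y
... | inj₁ x≤y rewrite m≤n⇒m⊓n≡m x≤y | m≥n⇒m⊔n≡m x≤y = refl
... | inj₂ y≤x rewrite m≥n⇒m⊓n≡n y≤x | m≤n⇒m⊔n≡n y≤x = +-comm (bit (y <ᵇ p)) _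

module States (B : ℕ) where

  open Rows B

  -- `WF` fixes cumulative counts; splitting off the rows labelled exactly `p` recovers the
  -- multiplicities that `target` compares.
  #-split : ∀ u p v → # (uses u (suc p)) v ≡ # (uses u p) v + # (λ x → u x ≡ᵇ p) v
  #-split u p = downward _
    (λ v B≤v → trans (#-end _ B≤v) (sym (cong₂ _+_ (#-end (uses u p) B≤v) (#-end (λ x → u x ≡ᵇ p) B≤v))))
    λ v v<B ih → trans (#-step (uses u (suc p)) v<B)
      (trans (cong₂ _+_ (bit-split (u v) p) ih)
      (trans (interchange (bit (u v <ᵇ p)) (bit (u v ≡ᵇ p)) _ _)
        (sym (cong₂ _+_ (#-step (uses u p) v<B) (#-step (λ x → u x ≡ᵇ p) v<B)))))
    where
    interchange : ∀ a b c d → (a + b) + (c + d) ≡ (a + c) + (b + d)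
    interchange = solve-∀

  -- The tableau criterion for Bruhat order.  The total numbers of labels need not
  -- agree, so that passing to fewer labels is a lowering too.
  infix 4 _⊑_
  _⊑_ : State → State → Set
  u ⊑ s = ∀ p v → p ≤ B → # (uses u p) v ≤ # (uses s p) v

  ⊑-refl : ∀ {u} → u ⊑ u
  ⊑-refl p v _ = ≤-refl

  ⊑-trans : ∀ {u v w} → u ⊑ v → v ⊑ w → u ⊑ w
  ⊑-trans h k p v p≤B = ≤-trans (h p v p≤B) (k p v p≤B)

  -- u carries the same multiset of labels as w.
  record WF (w u : State) : Set where
    constructor wf
    field
      outside : ∀ v → B ≤ v → B ≤ u v
      labels  : ∀ p → p ≤ B → # (uses u p) 0 ≡ # (uses w p) 0
  open WF public

  -- Row `v` makes the cumulative count of `u` grow strictly between the thresholds `u v` and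
  -- `suc (u v)`. The totals of `w` are the same, so some row of `w` has this label.
  WF-label : ∀ {w u v} → WF w u → u v < B → ∃[ x ] w x ≡ u v
  WF-label {w} {u} {v} h uv<B with v <? B
  ... | no v≮B = contradiction uv<B (≤⇒≯ (outside h v (≮⇒≥ v≮B)))
  ... | yes v<B with #-witness (uses w (u v)) (uses w (suc (u v))) 0
                       (subst₂ _<_ (labels h (u v) (<⇒≤ uv<B)) (labels h (suc (u v)) uv<B)
                         (#-strict (uses u (u v)) (uses u (suc (u v)))
                           (λ x e → <ᵇ-true (m<n⇒m<1+n (true-<ᵇ {u x} e)))
                           v<B (<ᵇ-false (≤-refl {u v})) (<ᵇ-true (n<1+n (u v))) 0 z≤n))
  ... | x , _ , _ , f , t = x , ≤-antisym (≤-pred (true-<ᵇ {w x} t)) (false-<ᵇ f)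

  module Exchange (u : State) {a e : ℕ} (a<e : a < e) (e<B : e < B) (p : ℕ) =
    Transposed (uses u p) (uses (exchange u a e) p) a<e e<B
      (cong (_<ᵇ p) (exchange-fst u a e))
      (cong (_<ᵇ p) (exchange-snd u a<e))
      (λ x x≢a x≢e → cong (_<ᵇ p) (exchange-other u a e x x≢a x≢e))

  ⊑-exchange : ∀ u {a e} → a < e → e < B → u a ≤ u e → u ⊑ exchange u a e
  ⊑-exchange u {a} {e} a<e e<B ua≤ue p v _ with v ≤? a | v ≤? e
  ... | yes v≤a | _ = ≤-reflexive (sym (Exchange.below u a<e e<B p v v≤a))
  ... | no _ | no v≰e = ≤-reflexive (sym (Exchange.above u a<e e<B p v (≰⇒> v≰e)))
  ... | no v≰a | yes v≤e = +-cancelʳ-≤ (bit (u e <ᵇ p)) _ _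
        (subst (# (uses u p) v + bit (u e <ᵇ p) ≤_) (sym (Exchange.between u a<e e<B p v (≰⇒> v≰a) v≤e))
          (+-monoʳ-≤ (# (uses u p) v) (bit-mono λ t → <ᵇ-true (≤-<-trans ua≤ue (true-<ᵇ {u e} {p} t)))))

  WF-exchange : ∀ {w} u {a e} → a < e → e < B → WF w u → WF w (exchange u a e)
  WF-exchange {w} u {a} {e} a<e e<B h = wf
    (λ v B≤v → subst (B ≤_) (sym (exchange-other u a e v
       (λ { refl → <-irrefl refl (<-≤-trans (<-trans a<e e<B) B≤v) })
       (λ { refl → <-irrefl refl (<-≤-trans e<B B≤v) }))) (outside h v B≤v))
    (λ p p≤B → trans (Exchange.below u a<e e<B p 0 z≤n) (labels h p p≤B))

  module _ {r : ℕ} (r+1<B : suc r < B) where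

    ⊑-sortAt : ∀ u → u ⊑ sortAt r u
    ⊑-sortAt u with u r <ᵇ u (suc r) in eq
    ... | false = ⊑-refl {u}
    ... | true  = ⊑-exchange u (n<1+n r) r+1<B (<⇒≤ (true-<ᵇ eq))

    WF-sortAt : ∀ {w} u → WF w u → WF w (sortAt r u)
    WF-sortAt u h with u r <ᵇ u (suc r)
    ... | false = h
    ... | true  = WF-exchange u (n<1+n r) r+1<B h

    -- The lifting property of Bruhat order. Only the suffix starting at `suc r` changes. If `s` has
    -- no label below `p` in row `suc r`, then by `closed` it has none in row `r` either, and the
    -- comparison at row `r` already contains the extra unit.
    sortAt-least : ∀ {u s} → u ⊑ s → s (suc r) ≤ s r → sortAt r u ⊑ s
    sortAt-least {u} {s} u⊑s closed p v p≤B with u r <ᵇ u (suc r)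
    ... | false = u⊑s p v p≤B
    ... | true with v ≤? r | v ≤? suc r
    ...   | yes v≤r | _ = ≤-trans (≤-reflexive (Exchange.below u (n<1+n r) r+1<B p v v≤r)) (u⊑s p v p≤B)
    ...   | no _ | no v≰ = ≤-trans (≤-reflexive (Exchange.above u (n<1+n r) r+1<B p v (≰⇒> v≰))) (u⊑s p v p≤B)
    ...   | no v≰r | yes v≤r+1 with ≤-antisym v≤r+1 (≰⇒> v≰r)
    ...   | refl = subst (_≤ # (uses s p) (suc r)) (sym lhs) bound
      where
      u″ = # (uses u p) (suc (suc r))
      s″ = # (uses s p) (suc (suc r))
      r<B = <-trans (n<1+n r) r+1<B
      lhs : # (uses (exchange u r (suc r)) p) (suc r) ≡ bit (u r <ᵇ p) + u″
      lhs = trans (#-step _ r+1<B) (cong₂ (λ a b → bit (a <ᵇ p) + b) (exchange-snd u (n<1+n r))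
              (Exchange.above u (n<1+n r) r+1<B p (suc (suc r)) (n<1+n (suc r))))
      bound : bit (u r <ᵇ p) + u″ ≤ # (uses s p) (suc r)
      bound with u r <ᵇ p in ur
      ... | false = ≤-trans (u⊑s p (suc (suc r)) p≤B) (#-suc≤ (uses s p) (suc r))
      ... | true with s (suc r) <ᵇ p in sr+1
      ...   | true = subst (suc u″ ≤_) (sym (trans (#-step (uses s p) r+1<B) (cong (λ b → bit b + s″) sr+1)))
                       (s≤s (u⊑s p (suc (suc r)) p≤B))
      ...   | false = begin
        suc u″                                ≤⟨ s≤s (#-suc≤ (uses u p) (suc r)) ⟩
        suc (# (uses u p) (suc r))            ≡⟨ sym (trans (#-step (uses u p) r<B) (cong (λ b → bit b + # (uses u p) (suc r)) ur)) ⟩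
        # (uses u p) r                        ≤⟨ u⊑s p r p≤B ⟩
        # (uses s p) r                        ≡⟨ trans (#-step (uses s p) r<B) (cong (λ b → bit b + # (uses s p) (suc r)) (<ᵇ-false (≤-trans (false-<ᵇ {s (suc r)} {p} sr+1) closed))) ⟩
        # (uses s p) (suc r)                  ∎
        where open ≤-Reasoning

  module _ {a : ℕ} (a<B : a < B) where

    kick-count-below : ∀ u p v → a < v → # (uses (kick a u) p) v ≡ # (uses u p) v
    kick-count-below u p v a<v = #-cong _ _ v λ x v≤x _ → cong (_<ᵇ p) (kick-below u (<-≤-trans a<v v≤x))

    -- Conservation of labels during the insertion: the rows from `v` on lose the label passed on by
    -- row `v`, which is `maxTo a u v`, and gain the one that row `a` finally receives,
    -- `maxTo a u 0`.
    kick-count : ∀ u p v → v ≤ a → # (uses (kick a u) p) v + bit (maxTo a u v <ᵇ p) ≡ # (uses u p) v + bit (maxTo a u 0 <ᵇ p)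
    kick-count u p = downward _
      (λ v B≤v v≤a → contradiction (≤-<-trans v≤a a<B) (≤⇒≯ B≤v)) step
      where
      open ≡-Reasoning
      swap₃ : ∀ x y z → x + y + z ≡ z + y + x
      swap₃ = solve-∀
      rotate : ∀ x y z → x + y + z ≡ (x + z) + y
      rotate = solve-∀
      rotate′ : ∀ x y z → (x + y) + z ≡ y + (z + x)
      rotate′ = solve-∀
      step : ∀ v → v < B
           → (suc v ≤ a → # (uses (kick a u) p) (suc v) + bit (maxTo a u (suc v) <ᵇ p) ≡ # (uses u p) (suc v) + bit (maxTo a u 0 <ᵇ p))
           → v ≤ a → # (uses (kick a u) p) v + bit (maxTo a u v <ᵇ p) ≡ # (uses u p) v + bit (maxTo a u 0 <ᵇ p)
      step v v<B ih v≤a rewrite #-step (uses (kick a u) p) v<B | #-step (uses u p) v<B with m≤n⇒m<n∨m≡n v≤a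
      ... | inj₂ refl rewrite kick-at a u | kick-count-below u p (suc a) (n<1+n a) | maxTo-end a u =
        swap₃ (bit (maxTo a u 0 <ᵇ p)) (# (uses u p) (suc a)) (bit (u a <ᵇ p))
      ... | inj₁ v<a rewrite kick-above u v<a | maxTo-step u v<a = begin
        bit (M ⊓ u v <ᵇ p) + K + bit (u v ⊔ M <ᵇ p)      ≡⟨ rotate (bit (M ⊓ u v <ᵇ p)) K _ ⟩
        bit (M ⊓ u v <ᵇ p) + bit (u v ⊔ M <ᵇ p) + K      ≡⟨ cong (_+ K) (bit-min-max M (u v) p) ⟩
        bit (M <ᵇ p) + bit (u v <ᵇ p) + K                ≡⟨ rotate′ (bit (M <ᵇ p)) (bit (u v <ᵇ p)) K ⟩
        bit (u v <ᵇ p) + (K + bit (M <ᵇ p))              ≡⟨ cong (bit (u v <ᵇ p) +_) (ih v<a) ⟩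
        bit (u v <ᵇ p) + (# (uses u p) (suc v) + bit (maxTo a u 0 <ᵇ p)) ≡⟨ sym (+-assoc (bit (u v <ᵇ p)) _ _) ⟩
        bit (u v <ᵇ p) + # (uses u p) (suc v) + bit (maxTo a u 0 <ᵇ p)   ∎
        where
        M = maxTo a u (suc v)
        K = # (uses (kick a u) p) (suc v)

    WF-kick : ∀ {w} u → WF w u → WF w (kick a u)
    WF-kick u h = wf
      (λ v B≤v → subst (B ≤_) (sym (kick-below u (<-≤-trans a<B B≤v))) (outside h v B≤v))
      (λ p p≤B → trans (+-cancelʳ-≡ (bit (maxTo a u 0 <ᵇ p)) _ _ (kick-count u p 0 z≤n)) (labels h p p≤B))

    private
      count-full : ∀ u p v → v ≤ a → (maxTo a u v <ᵇ p) ≡ true → # (uses u p) v ≡ (suc a ∸ v) + # (uses u p) (suc a)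
      count-full u p v v≤a e = #-full′ _ (m≤n⇒m≤1+n v≤a) a<B
        λ x v≤x x≤a → <ᵇ-true (≤-<-trans (maxTo-upper a u v x v≤x (≤-pred x≤a)) (true-<ᵇ {maxTo a u v} {p} e))

      count-hole : ∀ u p v → v ≤ a → (maxTo a u v <ᵇ p) ≡ false → # (uses u p) v ≤ (a ∸ v) + # (uses u p) (suc a)
      count-hole u p v v≤a e with maxTo-attained a u v v≤a
      ... | i , v≤i , i≤a , eq = #-hole _ v≤i i≤a (trans (cong (_<ᵇ p) (sym eq)) e)

      max-shrinks : ∀ u p v → v ≤ a → (maxTo a u 0 <ᵇ p) ≡ true → (maxTo a u v <ᵇ p) ≡ true
      max-shrinks u p v v≤a e with maxTo-attained a u v v≤a
      ... | i , _ , i≤a , eq = <ᵇ-true (≤-<-trans (≤-trans (≤-reflexive eq) (maxTo-upper a u 0 i z≤n i≤a)) (true-<ᵇ {maxTo a u 0} {p} e))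

    -- A suffix count of `s` drops, and then by one, only if all labels in rows `v` to `a` lie below
    -- `p` while some label further up does not. In that case the count for `u` is strictly smaller:
    -- either `u` has a large label among rows `v` to `a`, or its own count drops, or all its rows
    -- up to `a` lie below `p` and the comparison at row 0 becomes strict below row `a`.
    kick-mono : ∀ {u s} → u ⊑ s → kick a u ⊑ kick a s
    kick-mono {u} {s} u⊑s p v p≤B with v ≤? a
    ... | no v≰a = subst₂ _≤_ (sym (kick-count-below u p v (≰⇒> v≰a))) (sym (kick-count-below s p v (≰⇒> v≰a))) (u⊑s p v p≤B)
    ... | yes v≤a = main
      where
      open ≤-Reasoning
      U = # (uses u p) v
      S = # (uses s p) v
      U′ = # (uses (kick a u) p) v
      S′ = # (uses (kick a s) p) v
      sa : suc a ∸ v ≡ suc (a ∸ v)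
      sa = +-∸-assoc 1 v≤a
      eu : U′ + bit (maxTo a u v <ᵇ p) ≡ U + bit (maxTo a u 0 <ᵇ p)
      eu = kick-count u p v v≤a
      es : S′ + bit (maxTo a s v <ᵇ p) ≡ S + bit (maxTo a s 0 <ᵇ p)
      es = kick-count s p v v≤a
      U′≤U : U′ ≤ U
      U′≤U = +-cancelʳ-≤ (bit (maxTo a u v <ᵇ p)) _ _
        (≤-trans (≤-reflexive eu) (+-monoʳ-≤ U (bit-mono (max-shrinks u p v v≤a))))
      main : U′ ≤ S′
      main with maxTo a s 0 <ᵇ p in s0 | maxTo a s v <ᵇ p in sv | es
      ... | true | b | e rewrite trans (sym sv) (max-shrinks s p v v≤a s0) = ≤-trans U′≤U (≤-trans (u⊑s p v p≤B) (≤-reflexive (+-cancelʳ-≡ 1 _ _ (sym e))))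
      ... | false | false | e = ≤-trans U′≤U (≤-trans (u⊑s p v p≤B) (≤-reflexive (+-cancelʳ-≡ 0 _ _ (sym e))))
      ... | false | true | e = ≤-pred (begin
          suc U′      ≤⟨ gap< ⟩
          S           ≡⟨ sym (+-identityʳ S) ⟩
          S + 0       ≡⟨ sym e ⟩
          S′ + 1      ≡⟨ +-comm S′ 1 ⟩
          suc S′      ∎)
        where
        Ua = # (uses u p) (suc a)
        Sa = # (uses s p) (suc a)
        fullS : S ≡ suc (a ∸ v) + Sa
        fullS = trans (count-full s p v v≤a sv) (cong (_+ Sa) sa)
        gap< : suc U′ ≤ S
        gap< with maxTo a u v <ᵇ p in uv | maxTo a u 0 <ᵇ p in u0 | eu
        ... | false | _ | _ = begin
          suc U′               ≤⟨ s≤s U′≤U ⟩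
          suc U                ≤⟨ s≤s (count-hole u p v v≤a uv) ⟩
          suc (a ∸ v) + Ua     ≤⟨ +-monoʳ-≤ (suc (a ∸ v)) (u⊑s p (suc a) p≤B) ⟩
          suc (a ∸ v) + Sa     ≡⟨ sym fullS ⟩
          S                    ∎
        ... | true | false | e′ = begin
          suc U′               ≡⟨ +-comm 1 U′ ⟩
          U′ + 1               ≡⟨ e′ ⟩
          U + 0                ≡⟨ +-identityʳ U ⟩
          U                    ≤⟨ u⊑s p v p≤B ⟩
          S                    ∎
        ... | true | true | _ = begin
          suc U′                      ≤⟨ s≤s U′≤U ⟩
          suc U                       ≡⟨ cong suc (trans (count-full u p v v≤a uv) (cong (_+ Ua) sa)) ⟩
          suc (suc (a ∸ v) + Ua)      ≡⟨ sym (+-suc (suc (a ∸ v)) Ua) ⟩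
          suc (a ∸ v) + suc Ua        ≤⟨ +-monoʳ-≤ (suc (a ∸ v)) Ua<Sa ⟩
          suc (a ∸ v) + Sa            ≡⟨ sym fullS ⟩
          S                           ∎
          where
          Ua<Sa : Ua < Sa
          Ua<Sa = +-cancelˡ-≤ a _ _ (begin
            a + suc Ua               ≡⟨ +-suc a Ua ⟩
            suc a + Ua               ≡⟨ sym (count-full u p 0 z≤n u0) ⟩
            # (uses u p) 0           ≤⟨ u⊑s p 0 p≤B ⟩
            # (uses s p) 0           ≤⟨ count-hole s p 0 z≤n s0 ⟩
            a + Sa                   ∎)

    kick-⊑ : ∀ u → kick a u ⊑ u
    kick-⊑ u p v p≤B with v ≤? a
    ... | no v≰a = ≤-reflexive (kick-count-below u p v (≰⇒> v≰a))
    ... | yes v≤a = +-cancelʳ-≤ (bit (maxTo a u v <ᵇ p)) _ _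
      (≤-trans (≤-reflexive (kick-count u p v v≤a)) (+-monoʳ-≤ (# (uses u p) v) (bit-mono (max-shrinks u p v v≤a))))

-- Chains of states and their closure properties

-- t j v says whether column j has a cell in row v (the column comes first).
Columns : Set
Columns = ℕ → ℕ → Bool

infixr 5 _◂_
_◂_ : (ℕ → Bool) → Columns → Columns
(c ◂ t) zero    = c
(c ◂ t) (suc j) = t j

Agree : ℕ → Columns → Columns → Set
Agree n t t′ = ∀ j v → j < n → t j v ≡ t′ j v

record Move (n : ℕ) (t t′ : Columns) : Set where
  field
    {col from to} : ℕ
    col<n      : col < n
    filled     : t col from ≡ true
    rightmost  : ∀ j → col < j → j < n → t j from ≡ false
    to<from    : to < from
    empty      : t col to ≡ false
    jumped     : ∀ v → to < v → v < from → t col v ≡ true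
    left       : t′ col from ≡ false
    arrived    : t′ col to ≡ true
    otherRows  : ∀ v → v ≢ from → v ≢ to → t′ col v ≡ t col v
    otherCols  : ∀ j v → j < n → j ≢ col → t′ j v ≡ t j v

-- Columns are functions, so `done` asks for agreement on the first `n` columns in place of
-- equality.
data Reach (n : ℕ) (t t′ : Columns) : Set where
  done : Agree n t t′ → Reach n t t′
  step : ∀ {t₁} → Move n t t₁ → Reach n t₁ t′ → Reach n t t′

move-respˡ : ∀ {n s t t′} → Agree n s t → Move n t t′ → Move n s t′
move-respˡ s≈t m = record
  { col<n = col<n ; filled = trans (s≈t _ _ col<n) filled
  ; rightmost = λ j c<j j<n → trans (s≈t j _ j<n) (rightmost j c<j j<n)
  ; to<from = to<from ; empty = trans (s≈t _ _ col<n) empty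
  ; jumped = λ v p q → trans (s≈t _ v col<n) (jumped v p q)
  ; left = left ; arrived = arrived
  ; otherRows = λ v p q → trans (otherRows v p q) (sym (s≈t _ v col<n))
  ; otherCols = λ j v j<n p → trans (otherCols j v j<n p) (sym (s≈t j v j<n)) }
  where open Move m

reach-trans : ∀ {n s t t′} → Reach n s t → Reach n t t′ → Reach n s t′
reach-trans (step m p) q = step m (reach-trans p q)
reach-trans (done s≈t) (done t≈t′)  = done λ j v j<n → trans (s≈t j v j<n) (t≈t′ j v j<n)
reach-trans (done s≈t) (step m q)   = step (move-respˡ s≈t m) q

move-◂ : ∀ {n c s t} → Move n s t → Move (suc n) (c ◂ s) (c ◂ t)
move-◂ {n} {c} {s} {t} m = record
  { col = suc col ; from = from ; to = to
  ; col<n = s≤s col<n ; filled = filled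
  ; rightmost = λ { (suc j) (s≤s p) (s≤s q) → rightmost j p q }
  ; to<from = to<from ; empty = empty ; jumped = jumped
  ; left = left ; arrived = arrived ; otherRows = otherRows
  ; otherCols = λ { zero v _ _ → refl ; (suc j) v (s≤s j<n) p → otherCols j v j<n (p ∘ cong suc) } }
  where open Move m

reach-◂ : ∀ {n c d s t} → (∀ v → c v ≡ d v) → Reach n s t → Reach (suc n) (c ◂ s) (d ◂ t)
reach-◂ c≈d (done s≈t) = done λ { zero v _ → c≈d v ; (suc j) v (s≤s j<n) → s≈t j v j<n }
reach-◂ c≈d (step m p) = step (move-◂ m) (reach-◂ c≈d p)

module Chains (B : ℕ) where

  open Rows B
  open States B

  -- ℓ j is the set of labels of column j of D, and w j carries the labels that
  -- occur in some column ≥ j; P restricts the first state.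
  Chain : ℕ → (State → Set) → Columns → (ℕ → State) → Columns → Set
  Chain zero    P ℓ w t = ⊤
  Chain (suc n) P ℓ w t = ∃[ u ] (P u × WF (w 0) u × (∀ v → t 0 v ≡ ℓ 0 (u v))
                                 × Chain n (_⊑ u) (ℓ ∘ suc) (w ∘ suc) (t ∘ suc))

  -- What remains of the northwest condition in terms of labels.
  record Nested (ℓ : Columns) (w : ℕ → State) : Set where
    field
      bounded : ∀ j q → ℓ j q ≡ true → q < B
      closed  : ∀ j p x → ℓ j p ≡ true → w j x ≤ p → ℓ j (w j x) ≡ true

  nested-tail : ∀ {ℓ w} → Nested ℓ w → Nested (ℓ ∘ suc) (w ∘ suc)
  nested-tail h = record { bounded = bounded ∘ suc ; closed = closed ∘ suc }
    where open Nested h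

  module _ {ℓ w} (h : Nested ℓ w) {u} (wfu : WF (w 0) u) where
    open Nested h

    -- By `WF-label` every label in use in `u` is a label of `w`, where `closed` applies. So the
    -- occupied rows of a column are those whose labels stay below some threshold.
    smaller-present : ∀ {p v} → ℓ 0 p ≡ true → u v ≤ p → ℓ 0 (u v) ≡ true
    smaller-present {p} {v} ℓp uv≤p with WF-label wfu (≤-<-trans uv≤p (bounded 0 p ℓp))
    ... | x , wx≡uv = subst (λ q → ℓ 0 q ≡ true) wx≡uv (closed 0 p x ℓp (subst (_≤ p) (sym wx≡uv) uv≤p))

    present<absent : ∀ {v p} → ℓ 0 (u v) ≡ false → ℓ 0 p ≡ true → p < u v
    present<absent ℓuv ℓp = ≰⇒> λ uv≤p → true≢false (trans (sym (smaller-present ℓp uv≤p)) ℓuv)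

    larger-absent : ∀ {v q} → ℓ 0 (u v) ≡ false → u v ≤ q → ℓ 0 q ≡ false
    larger-absent {v} {q} ℓuv uv≤q with ℓ 0 q in eq
    ... | false = refl
    ... | true  = contradiction (present<absent {v} ℓuv eq) (≤⇒≯ uv≤q)

    unused-absent : ∀ {q} → B ≤ q → ℓ 0 q ≡ false
    unused-absent {q} B≤q with ℓ 0 q in eq
    ... | false = refl
    ... | true  = contradiction (bounded 0 q eq) (≤⇒≯ B≤q)

    present⇒row<B : ∀ {v} → ℓ 0 (u v) ≡ true → v < B
    present⇒row<B {v} e = ≰⇒> λ B≤v → true≢false (trans (sym e) (unused-absent (outside wfu v B≤v)))

    -- Every present label is smaller than `u v`, hence than `m`, and survives the minimum; if `y`
    -- is absent, both candidates are.
    ⊓-absentˡ : ∀ {v m y} → ℓ 0 (u v) ≡ false → u v ≤ m → ℓ 0 (m ⊓ y) ≡ ℓ 0 y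
    ⊓-absentˡ {v} {m} {y} ℓuv uv≤m with ℓ 0 y in eq
    ... | true  = trans (cong (ℓ 0) (m≥n⇒m⊓n≡n (<⇒≤ (<-≤-trans (present<absent {v} ℓuv eq) uv≤m)))) eq
    ... | false with ⊓-sel m y
    ...   | inj₁ e = trans (cong (ℓ 0) e) (larger-absent {v} ℓuv uv≤m)
    ...   | inj₂ e = trans (cong (ℓ 0) e) eq

  chain-map : ∀ n {P Q : State → Set} {ℓ w t} → (∀ {u} → P u → Q u) → Chain n P ℓ w t → Chain n Q ℓ w t
  chain-map zero    f _ = tt
  chain-map (suc n) f (u , Pu , rest) = u , f Pu , rest

  chain-raise : ∀ n {u s ℓ w t} → u ⊑ s → Chain n (_⊑ u) ℓ w t → Chain n (_⊑ s) ℓ w t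
  chain-raise n {u} {s} u⊑s = chain-map n λ {x} x⊑u → ⊑-trans {x} {u} {s} x⊑u u⊑s

  chain-agree : ∀ n {P ℓ w t t′} → Agree n t t′ → Chain n P ℓ w t → Chain n P ℓ w t′
  chain-agree zero    a _ = tt
  chain-agree (suc n) a (u , Pu , wfu , em , c) =
    u , Pu , wfu , (λ v → trans (sym (a 0 v (s≤s z≤n))) (em v))
      , chain-agree n (λ j v j<n → a (suc j) v (s≤s j<n)) c

  -- The label in transit is never smaller than that of row `a`, which is absent, so by `⊓-absentˡ`
  -- no column changes; `kick-mono` keeps successive states comparable.
  chain-kick : ∀ n {P Q ℓ w t a} → Nested ℓ w → a < B → (∀ {u} → P u → Q (kick a u))
             → (∀ j → j < n → t j a ≡ false) → Chain n P ℓ w t → Chain n Q ℓ w t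
  chain-kick zero    _ _ _ _ _ = tt
  chain-kick (suc n) {ℓ = ℓ} {t = t} {a} h a<B f free (u , Pu , wfu , em , c) =
    kick a u , f Pu , WF-kick a<B u wfu , em′
    , chain-kick n (nested-tail h) a<B (λ {x} x⊑u → kick-mono a<B {x} {u} x⊑u)
        (λ j j<n → free (suc j) (s≤s j<n)) c
    where
    ℓua : ℓ 0 (u a) ≡ false
    ℓua = trans (sym (em a)) (free 0 (s≤s z≤n))
    em′ : ∀ v → t 0 v ≡ ℓ 0 (kick a u v)
    em′ v with <-cmp v a
    ... | tri< v<a _ _ = trans (em v) (trans (sym (⊓-absentˡ h wfu {a} ℓua (maxTo-upper a u (suc v) a v<a ≤-refl)))
                                             (cong (ℓ 0) (sym (kick-above u v<a))))
    ... | tri≈ _ refl _ = trans (free 0 (s≤s z≤n)) (sym (trans (cong (ℓ 0) (kick-at a u))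
                            (larger-absent h wfu {a} ℓua (maxTo-upper a u 0 a z≤n ≤-refl))))
    ... | tri> _ _ a<v = trans (em v) (cong (ℓ 0) (sym (kick-below u a<v)))

  -- The column in which a cell moves from row `a` to row `b`. Until row `b` the label in transit is
  -- a present one; row `b` keeps it and passes on its own larger, absent one. From there on only
  -- absent labels travel, and one of them ends in row `a`.
  module KickFirst {ℓ w u} (h : Nested ℓ w) (wfu : WF (w 0) u) {a b : ℕ} (b<a : b < a)
    (ℓub : ℓ 0 (u b) ≡ false) (ℓu : ∀ v → b < v → v ≤ a → ℓ 0 (u v) ≡ true) where

    private
      max-present : ∀ v → b ≤ v → v < a → ℓ 0 (maxTo a u (suc v)) ≡ true
      max-present v b≤v v<a with maxTo-attained a u (suc v) v<a
      ... | i , v<i , i≤a , e = trans (cong (ℓ 0) e) (ℓu i (≤-<-trans b≤v v<i) i≤a)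

    kick-first-between : ∀ v → b < v → v < a → ℓ 0 (kick a u v) ≡ true
    kick-first-between v b<v v<a rewrite kick-above u v<a with ⊓-sel (maxTo a u (suc v)) (u v)
    ... | inj₁ e = trans (cong (ℓ 0) e) (max-present v (<⇒≤ b<v) v<a)
    ... | inj₂ e = trans (cong (ℓ 0) e) (ℓu v b<v (<⇒≤ v<a))

    kick-first-to : ℓ 0 (kick a u b) ≡ true
    kick-first-to rewrite kick-above u b<a =
      trans (cong (ℓ 0) (m≤n⇒m⊓n≡m (<⇒≤ (present<absent h wfu {b} ℓub (max-present b ≤-refl b<a)))))
            (max-present b ≤-refl b<a)

    kick-first-above : ∀ v → v < b → ℓ 0 (kick a u v) ≡ ℓ 0 (u v)
    kick-first-above v v<b rewrite kick-above u (<-trans v<b b<a) =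
      ⊓-absentˡ h wfu {b} ℓub (maxTo-upper a u (suc v) b v<b (<⇒≤ b<a))

    kick-first-from : ℓ 0 (kick a u a) ≡ false
    kick-first-from rewrite kick-at a u = larger-absent h wfu {b} ℓub (maxTo-upper a u 0 b z≤n (<⇒≤ b<a))

  -- The states of the columns left of the moved cell stay, since a kick only lowers the state that
  -- follows (`kick-⊑`). At the column itself `KickFirst` applies. The moved cell is rightmost in
  -- its row, so `chain-kick` handles the columns to its right.
  chain-move : ∀ n {P ℓ w t t′} → Nested ℓ w → (∀ {a u} → a < B → P u → P (kick a u))
             → Move n t t′ → Chain n P ℓ w t → Chain n P ℓ w t′
  chain-move (suc n) {P} {ℓ} {w} {t} {t′} h f m (u , Pu , wfu , em , c) = go (Move.col m) refl
    where
    open Move m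
    go : ∀ k → k ≡ col → Chain (suc n) P ℓ w t′
    go (suc k) refl = u , Pu , wfu , (λ v → trans (otherCols 0 v (s≤s z≤n) λ ()) (em v))
      , chain-move n (nested-tail h)
          (λ {a} {x} a<B x⊑u → ⊑-trans {kick a x} {x} {u} (kick-⊑ a<B x) x⊑u) tail-move c
      where
      tail-move : Move n (t ∘ suc) (t′ ∘ suc)
      tail-move = record
        { col<n = ≤-pred col<n ; filled = filled
        ; rightmost = λ j p q → rightmost (suc j) (s≤s p) (s≤s q)
        ; to<from = to<from ; empty = empty ; jumped = jumped
        ; left = left ; arrived = arrived ; otherRows = otherRows
        ; otherCols = λ j v j<n p → otherCols (suc j) v (s≤s j<n) (p ∘ suc-injective) }
    go zero refl = kick from u , f from<B Pu , WF-kick from<B u wfu , em′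
      , chain-agree n (λ j v j<n → sym (otherCols (suc j) v (s≤s j<n) λ ()))
          (chain-kick n (nested-tail h) from<B (λ {x} x⊑u → kick-mono from<B {x} {u} x⊑u)
            (λ j j<n → rightmost (suc j) (s≤s z≤n) (s≤s j<n)) c)
      where
      from<B : from < B
      from<B = present⇒row<B h wfu (trans (sym (em from)) filled)
      present : ∀ v → to < v → v ≤ from → ℓ 0 (u v) ≡ true
      present v to<v v≤from with m≤n⇒m<n∨m≡n v≤from
      ... | inj₁ v<from = trans (sym (em v)) (jumped v to<v v<from)
      ... | inj₂ refl   = trans (sym (em v)) filled
      open KickFirst h wfu to<from (trans (sym (em to)) empty) present
      em′ : ∀ v → t′ 0 v ≡ ℓ 0 (kick from u v)
      em′ v with <-cmp v to | <-cmp v from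
      ... | tri≈ _ refl _ | _ = trans arrived (sym kick-first-to)
      ... | _ | tri≈ _ refl _ = trans left (sym kick-first-from)
      ... | tri< v<to _ _ | tri< v<from _ _ = trans (otherRows v (<⇒≢ v<from) (<⇒≢ v<to))
                                                (trans (em v) (sym (kick-first-above v v<to)))
      ... | tri> _ _ to<v | tri< v<from _ _ = trans (otherRows v (<⇒≢ v<from) (>⇒≢ to<v))
                                                (trans (jumped v to<v v<from) (sym (kick-first-between v to<v v<from)))
      ... | tri< v<to _ _ | tri> _ _ from<v = contradiction (<-trans v<to (<-trans to<from from<v)) (<-irrefl refl)
      ... | tri> _ _ to<v | tri> _ _ from<v = trans (otherRows v (>⇒≢ from<v) (>⇒≢ to<v))
                                                (trans (em v) (cong (ℓ 0) (sym (kick-below u from<v))))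

  -- The cell moved by f_r may sit in any column preceded only by neutral columns, or
  -- by neutral columns after a column with a cell in row r + 1 but not in row r:
  -- such a column forces u (r + 1) < u r, by Nested.
  module Lowering {r : ℕ} (r+1<B : suc r < B) where

    record Lowered (n c : ℕ) (t t′ : Columns) : Set where
      field
        c<n       : c < n
        source     : t c r ≡ true
        target     : t c (suc r) ≡ false
        source′    : t′ c r ≡ false
        target′    : t′ c (suc r) ≡ true
        otherRows : ∀ v → v ≢ r → v ≢ suc r → t′ c v ≡ t c v
        otherCols : ∀ j v → j < n → j ≢ c → t′ j v ≡ t j v

    lowered-tail : ∀ {n c t t′} → Lowered (suc n) (suc c) t t′ → Lowered n c (t ∘ suc) (t′ ∘ suc)
    lowered-tail m = record
      { c<n = ≤-pred c<n ; source = source ; target = target ; source′ = source′ ; target′ = target′ ; otherRows = otherRows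
      ; otherCols = λ j v j<n p → otherCols (suc j) v (s≤s j<n) (p ∘ suc-injective) }
      where open Lowered m

    sortAt-neutral : ∀ (f : ℕ → Bool) u → f (u r) ≡ f (u (suc r)) → ∀ v → f (sortAt r u v) ≡ f (u v)
    sortAt-neutral f u e v with u r <ᵇ u (suc r)
    ... | false = refl
    ... | true with v ≟ r | v ≟ suc r
    ...   | yes refl | _ = trans (cong f (exchange-fst u r (suc r))) (sym e)
    ...   | no _ | yes refl = trans (cong f (exchange-snd u (n<1+n r))) e
    ...   | no p | no q = cong f (exchange-other u r (suc r) v p q)

    sortAt-< : ∀ u → u r < u (suc r) → ∀ v → sortAt r u v ≡ exchange u r (suc r) v
    sortAt-< u lt v rewrite <ᵇ-true lt = refl

    -- A present label in row `r` and an absent one in row `suc r` force `u r < u (suc r)`, so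
    -- `sortAt` does exchange them. The state only goes up, so the rest of the chain stays below it.
    chain-lower-here : ∀ n {P ℓ w t t′} → Nested ℓ w → (∀ {u} → P u → P (sortAt r u))
      → Lowered n 0 t t′ → Chain n P ℓ w t → Chain n P ℓ w t′
    chain-lower-here zero _ _ _ _ = tt
    chain-lower-here (suc n) {ℓ = ℓ} {t = t} {t′} h f m (u , Pu , wfu , em , c) =
      sortAt r u , f Pu , WF-sortAt r+1<B u wfu , em′
      , chain-agree n (λ j v j<n → sym (otherCols (suc j) v (s≤s j<n) λ ()))
          (chain-raise n {u} {sortAt r u} (⊑-sortAt r+1<B u) c)
      where
      open Lowered m
      ℓr = trans (sym (em r)) source
      ℓr+1 = trans (sym (em (suc r))) target
      em′ : ∀ v → t′ 0 v ≡ ℓ 0 (sortAt r u v)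
      em′ v rewrite sortAt-< u (present<absent h wfu {suc r} ℓr+1 ℓr) v with v ≟ r | v ≟ suc r
      ... | yes refl | _ rewrite exchange-fst u r (suc r) = trans source′ (sym ℓr+1)
      ... | no _ | yes refl rewrite exchange-snd u (n<1+n r) = trans target′ (sym ℓr)
      ... | no p | no q rewrite exchange-other u r (suc r) v p q = trans (otherRows v p q) (em v)

    -- In a neutral column the two labels are both present or both absent, so sorting them leaves
    -- the column as it is. Each sorted state bounds the next one even after that one is sorted, by
    -- `sortAt-least`.
    chain-lower-neutral : ∀ n c {P ℓ w t t′} → Nested ℓ w → (∀ {u} → P u → P (sortAt r u))
      → (∀ j → j < c → t j r ≡ t j (suc r)) → Lowered n c t t′ → Chain n P ℓ w t → Chain n P ℓ w t′
    chain-lower-neutral n zero h f _ m c = chain-lower-here n h f m c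
    chain-lower-neutral zero (suc _) _ _ _ _ _ = tt
    chain-lower-neutral (suc n) (suc c) {ℓ = ℓ} {t = t} {t′} h f neutral m (u , Pu , wfu , em , rest) =
      sortAt r u , f Pu , WF-sortAt r+1<B u wfu
      , (λ v → trans (Lowered.otherCols m 0 v (s≤s z≤n) λ ())
          (trans (em v) (sym (sortAt-neutral (ℓ 0) u (trans (sym (em r)) (trans (neutral 0 (s≤s z≤n)) (em (suc r)))) v))))
      , chain-lower-neutral n c (nested-tail h)
          (λ {x} x⊑ → sortAt-least r+1<B {x} {sortAt r u} x⊑ sorted)
          (λ j j<c → neutral (suc j) (s≤s j<c)) (lowered-tail m)
          (chain-raise n {u} {sortAt r u} (⊑-sortAt r+1<B u) rest)
      where
      sorted : sortAt r u (suc r) ≤ sortAt r u r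
      sorted with u r <ᵇ u (suc r) in eq
      ... | false = false-<ᵇ eq
      ... | true  = subst₂ _≤_ (sym (exchange-snd u (n<1+n r))) (sym (exchange-fst u r (suc r))) (<⇒≤ (true-<ᵇ eq))

    chain-lower-after : ∀ n i c {P ℓ w t t′} → Nested ℓ w → i < c
      → t i r ≡ false → t i (suc r) ≡ true → (∀ j → i < j → j < c → t j r ≡ t j (suc r))
      → Lowered n c t t′ → Chain n P ℓ w t → Chain n P ℓ w t′
    chain-lower-after zero _ _ _ _ _ _ _ _ _ = tt
    chain-lower-after (suc n) zero (suc c) h _ ti ti′ neutral m (u , Pu , wfu , em , rest) =
      u , Pu , wfu , (λ v → trans (Lowered.otherCols m 0 v (s≤s z≤n) λ ()) (em v))
      , chain-lower-neutral n c (nested-tail h)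
          (λ {x} x⊑u → sortAt-least r+1<B {x} {u} x⊑u
            (<⇒≤ (present<absent h wfu {r} (trans (sym (em r)) ti) (trans (sym (em (suc r))) ti′))))
          (λ j j<c → neutral (suc j) (s≤s z≤n) (s≤s j<c)) (lowered-tail m) rest
    chain-lower-after (suc n) (suc i) (suc c) h (s≤s i<c) ti ti′ neutral m (u , Pu , wfu , em , rest) =
      u , Pu , wfu , (λ v → trans (Lowered.otherCols m 0 v (s≤s z≤n) λ ()) (em v))
      , chain-lower-after n i c (nested-tail h) i<c ti ti′
          (λ j i<j j<c → neutral (suc j) (s≤s i<j) (s≤s j<c)) (lowered-tail m) rest

-- Admissible diagrams are reachable

module Reaching (B : ℕ) where

  open Rows B
  open States B
  open Chains B

  reach-hop : ∀ {n ℓ w u S a e} → Nested ℓ w → WF (w 0) u → a < e → e < B → B ≤ u e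
    → (∀ x → a < x → x < e → ℓ 0 (u a) ≡ true → ℓ 0 (u x) ≡ true)
    → (∀ j → j < n → S j e ≡ false)
    → Reach (suc n) ((λ v → ℓ 0 (exchange u a e v)) ◂ S) ((λ v → ℓ 0 (u v)) ◂ S)
  reach-hop {n} {ℓ} {w} {u} {S} {a} {e} h wfu a<e e<B B≤ue mid free with ℓ 0 (u a) in ℓua
  ... | false = done λ { zero v _ → same v ; (suc j) v _ → refl }
    where
    same : ∀ v → ℓ 0 (exchange u a e v) ≡ ℓ 0 (u v)
    same v with v ≟ a | v ≟ e
    ... | yes refl | _ = trans (cong (ℓ 0) (exchange-fst u a e)) (trans (unused-absent h wfu B≤ue) (sym ℓua))
    ... | no _ | yes refl = trans (cong (ℓ 0) (exchange-snd u a<e)) (trans ℓua (sym (unused-absent h wfu B≤ue)))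
    ... | no p | no q = cong (ℓ 0) (exchange-other u a e v p q)
  ... | true = step record
    { col = 0 ; from = e ; to = a ; col<n = s≤s z≤n
    ; filled = trans (cong (ℓ 0) (exchange-snd u a<e)) ℓua
    ; rightmost = λ { (suc j) _ (s≤s j<n) → free j j<n }
    ; to<from = a<e
    ; empty = trans (cong (ℓ 0) (exchange-fst u a e)) (unused-absent h wfu B≤ue)
    ; jumped = λ v a<v v<e → trans (cong (ℓ 0) (exchange-other u a e v (>⇒≢ a<v) (<⇒≢ v<e))) (mid v a<v v<e refl)
    ; left = unused-absent h wfu B≤ue
    ; arrived = ℓua
    ; otherRows = λ v p q → cong (ℓ 0) (sym (exchange-other u a e v q p))
    ; otherCols = λ { zero v _ p → contradiction refl p ; (suc j) v _ _ → refl } }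
    (done λ _ _ _ → refl)

  -- Named so that `clearRow` can take the statement for the later columns as a hypothesis. It
  -- matters that `S` obeys the same bound `s` as `t`.
  Clear : ℕ → Set
  Clear n = ∀ {ℓ w t s a} → Nested ℓ w → a < B → B ≤ s a → Chain n (_⊑ s) ℓ w t
    → ∃[ S ] (Chain n (_⊑ s) ℓ w S × (∀ j → j < n → S j a ≡ false) × Reach n S t)

  record Cleared (n : ℕ) (ℓ : Columns) (w : ℕ → State) (a : ℕ) (u : State) (T : Columns) : Set where
    field
      {u⁺}   : State
      {S}    : Columns
      unused : B ≤ u⁺ a
      wf⁺    : WF (w 0) u⁺
      rows<a : ∀ v → v < a → u⁺ v ≡ u v
      -- u⁺ is the least state above u in which row a is unused.
      least  : ∀ p v → p ≤ B → # (uses u⁺ p) v ≤ # (uses u p) v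
             ⊎ # (uses u⁺ p) v ≤ suc (# (uses u p) v) × a < v × (∀ x → a ≤ x → x < v → u x < p)
      chain  : Chain n (_⊑ u⁺) (ℓ ∘ suc) (w ∘ suc) S
      free   : ∀ j → j < n → S j a ≡ false
      reach  : Reach (suc n) ((λ v → ℓ 0 (u⁺ v)) ◂ S) ((λ v → ℓ 0 (u v)) ◂ T)

  clearRow : ∀ {n} → Clear n → ∀ {ℓ w} → Nested ℓ w → ∀ k {a e u T} → B ≤ k + a → a ≤ e → e < B → B ≤ u e
    → WF (w 0) u → Chain n (_⊑ u) (ℓ ∘ suc) (w ∘ suc) T → Cleared n ℓ w a u T
  clearRow clr h zero {a} {e} B≤a a≤e e<B = contradiction (≤-<-trans a≤e e<B) (≤⇒≯ B≤a)
  clearRow {n} clr {ℓ} {w} h (suc k) {a} {e} {u} {T} B≤ a≤e e<B B≤ue wfu c with B ≤? u a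
  ... | yes B≤ua = record
    { unused = B≤ua ; wf⁺ = wfu ; rows<a = λ _ _ → refl ; least = λ p v _ → inj₁ ≤-refl
    ; chain = proj₁ (proj₂ r) ; free = proj₁ (proj₂ (proj₂ r))
    ; reach = reach-◂ (λ _ → refl) (proj₂ (proj₂ (proj₂ r))) }
    where r = clr (nested-tail h) (≤-<-trans a≤e e<B) B≤ua c
  ... | no B≰ua with firstAbove (λ x → u a <? u x) {a} {e} (≤∧≢⇒< a≤e λ { refl → B≰ua B≤ue })
                       (<-≤-trans (≰⇒> B≰ua) B≤ue)
  ...   | i , a<i , i≤e , ua<ui , none = record
    { u⁺ = u⁺
    ; unused = subst (B ≤_) (sym (exchange-fst I.u⁺ a i)) I.unused
    ; wf⁺ = WF-exchange I.u⁺ a<i i<B I.wf⁺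
    ; rows<a = λ v v<a → trans (exchange-other I.u⁺ a i v (<⇒≢ v<a) (<⇒≢ (<-trans v<a a<i))) (I.rows<a v (<-trans v<a a<i))
    ; least = least
    ; chain = proj₁ (proj₂ r) ; free = proj₁ (proj₂ (proj₂ r))
    ; reach = reach-trans (reach-◂ (λ _ → refl) (proj₂ (proj₂ (proj₂ r))))
                (reach-trans (reach-hop h I.wf⁺ a<i i<B I.unused mid I.free) I.reach) }
    where
    i<B = ≤-<-trans i≤e e<B
    module I = Cleared (clearRow clr {ℓ} {w} h k {i} {e} {u} {T}
                 (≤-trans B≤ (subst (_≤ k + i) (+-suc k a) (+-monoʳ-≤ k a<i))) i≤e e<B B≤ue wfu c)
    u⁺ = exchange I.u⁺ a i
    ia : I.u⁺ a ≡ u a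
    ia = I.rows<a a a<i
    r = clr (nested-tail h) (<-trans a<i i<B) (subst (B ≤_) (sym (exchange-fst I.u⁺ a i)) I.unused)
          (chain-raise n {I.u⁺} {u⁺} (⊑-exchange I.u⁺ a<i i<B
            (<⇒≤ (<-≤-trans (subst (_< B) (sym ia) (≰⇒> B≰ua)) I.unused))) I.chain)
    mid : ∀ x → a < x → x < i → ℓ 0 (I.u⁺ a) ≡ true → ℓ 0 (I.u⁺ x) ≡ true
    mid x a<x x<i e rewrite I.rows<a x x<i | ia = smaller-present h wfu e (≮⇒≥ (none x a<x x<i))
    least : ∀ p v → p ≤ B → # (uses u⁺ p) v ≤ # (uses u p) v
          ⊎ # (uses u⁺ p) v ≤ suc (# (uses u p) v) × a < v × (∀ x → a ≤ x → x < v → u x < p)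
    least p v p≤B with v ≤? a | v ≤? i | I.least p v p≤B
    ... | yes v≤a | _ | inj₁ le = inj₁ (≤-trans (≤-reflexive (Exchange.below I.u⁺ a<i i<B p v v≤a)) le)
    ... | yes v≤a | _ | inj₂ (_ , i<v , _) = contradiction (<-trans a<i i<v) (≤⇒≯ v≤a)
    ... | no v≰a | yes v≤i | inj₂ (_ , i<v , _) = contradiction i<v (≤⇒≯ v≤i)
    ... | no v≰a | no v≰i | inj₁ le = inj₁ (≤-trans (≤-reflexive (Exchange.above I.u⁺ a<i i<B p v (≰⇒> v≰i))) le)
    ... | no v≰a | no v≰i | inj₂ (le , i<v , small) =
      inj₂ (≤-trans (≤-reflexive (Exchange.above I.u⁺ a<i i<B p v (≰⇒> v≰i))) le , ≰⇒> v≰a , small′)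
      where
      small′ : ∀ x → a ≤ x → x < v → u x < p
      small′ x a≤x x<v with i ≤? x
      ... | yes i≤x = small x i≤x x<v
      ... | no i≰x with m≤n⇒m<n∨m≡n a≤x
      ...   | inj₁ a<x  = ≤-<-trans (≮⇒≥ (none x a<x (≰⇒> i≰x))) (<-trans ua<ui (small i ≤-refl i<v))
      ...   | inj₂ refl = <-trans ua<ui (small i ≤-refl i<v)
    -- Only these suffixes gain the label `u a`. When it counts for `p`, the rows from `a` to just
    -- before `v` carry labels at most `u a`, hence below `p`.
    ... | no v≰a | yes v≤i | inj₁ le = split (u a <? p)
      where
      eq : # (uses u⁺ p) v ≡ # (uses I.u⁺ p) v + bit (u a <ᵇ p)
      eq = trans (sym (+-identityʳ _)) (trans
             (subst (λ b → # (uses u⁺ p) v + bit b ≡ # (uses I.u⁺ p) v + bit (I.u⁺ a <ᵇ p))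
               (<ᵇ-false (≤-trans p≤B I.unused)) (Exchange.between I.u⁺ a<i i<B p v (≰⇒> v≰a) v≤i))
             (cong (λ q → # (uses I.u⁺ p) v + bit (q <ᵇ p)) ia))
      split : Dec (u a < p) → _
      split (no ua≮p) = inj₁ (≤-trans (≤-reflexive (trans eq
        (trans (cong (λ b → # (uses I.u⁺ p) v + bit b) (<ᵇ-false (≮⇒≥ ua≮p))) (+-identityʳ _)))) le)
      split (yes ua<p) = inj₂ (≤-trans (≤-reflexive (trans eq
        (trans (cong (λ b → # (uses I.u⁺ p) v + bit b) (<ᵇ-true ua<p)) (+-comm _ 1)))) (s≤s le) , ≰⇒> v≰a , small)
        where
        small : ∀ x → a ≤ x → x < v → u x < p
        small x a≤x x<v with m≤n⇒m<n∨m≡n a≤x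
        ... | inj₁ a<x  = ≤-<-trans (≮⇒≥ (none x a<x (<-≤-trans x<v v≤i))) ua<p
        ... | inj₂ refl = ua<p

  module _ {w u s : State} {a : ℕ} (wfu : WF w u) (a<B : a < B) (B≤sa : B ≤ s a) (u⊑s : u ⊑ s) where

    private
      s-skip : ∀ p → p ≤ B → # (uses s p) a ≡ # (uses s p) (suc a)
      s-skip p p≤B = trans (#-step _ a<B) (cong (λ b → bit b + # (uses s p) (suc a)) (<ᵇ-false (≤-trans p≤B B≤sa)))

    unused-row : ∃[ e ] (a ≤ e × e < B × B ≤ u e)
    unused-row with #-witness (uses u B) (λ _ → true) a few
      where
      open ≤-Reasoning
      few : # (uses u B) a < # (λ _ → true) a
      few = begin
        suc (# (uses u B) a)             ≤⟨ s≤s (u⊑s B a ≤-refl) ⟩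
        suc (# (uses s B) a)             ≡⟨ cong suc (s-skip B ≤-refl) ⟩
        suc (# (uses s B) (suc a))       ≤⟨ s≤s (#-mono (uses s B) (λ _ → true) (suc a) λ _ _ _ _ → refl) ⟩
        suc (# (λ _ → true) (suc a))     ≡⟨ sym (#-step (λ _ → true) a<B) ⟩
        # (λ _ → true) a                 ∎
    ... | e , a≤e , e<B , f , _ = e , a≤e , e<B , false-<ᵇ f

    -- The surplus unit is absorbed at row `a`: all rows of `u` from `a` to just before `v` count
    -- for `p`, whereas row `a` of `s` does not. So the comparison at row `a` gives a strict one at
    -- `v`.
    cleared-⊑ : ∀ {u⁺} → (∀ p v → p ≤ B → # (uses u⁺ p) v ≤ # (uses u p) v
             ⊎ # (uses u⁺ p) v ≤ suc (# (uses u p) v) × a < v × (∀ x → a ≤ x → x < v → u x < p)) → u⁺ ⊑ s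
    cleared-⊑ least p v p≤B with least p v p≤B
    ... | inj₁ le = ≤-trans le (u⊑s p v p≤B)
    ... | inj₂ (le , a<v , small) = ≤-trans le (+-cancelˡ-≤ (v ∸ suc a) _ _ (begin
      (v ∸ suc a) + suc (# (uses u p) v)   ≡⟨ +-suc (v ∸ suc a) _ ⟩
      suc (v ∸ suc a) + # (uses u p) v     ≡⟨ cong (_+ # (uses u p) v) (sym (∸-suc a<v)) ⟩
      (v ∸ a) + # (uses u p) v             ≡⟨ sym (#-full′ (uses u p) (<⇒≤ a<v) v≤B λ x a≤x x<v → <ᵇ-true (small x a≤x x<v)) ⟩
      # (uses u p) a                       ≤⟨ u⊑s p a p≤B ⟩
      # (uses s p) a                       ≡⟨ s-skip p p≤B ⟩
      # (uses s p) (suc a)                 ≤⟨ #-≤-gap′ (uses s p) a<v ⟩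
      (v ∸ suc a) + # (uses s p) v         ∎))
      where
      open ≤-Reasoning
      v≤B : v ≤ B
      v≤B = ≮⇒≥ λ B<v → <-irrefl refl (<-≤-trans (small B (<⇒≤ a<B) B<v) (≤-trans p≤B (outside wfu B ≤-refl)))

  clear : ∀ n → Clear n
  clear zero {t = t} _ _ _ _ = t , tt , (λ _ ()) , done λ _ _ ()
  clear (suc n) {ℓ} {w} {t} {s} {a} h a<B B≤sa (u , u⊑s , wfu , em , c)
    with unused-row wfu a<B B≤sa u⊑s
  ... | e , a≤e , e<B , B≤ue = (λ v → ℓ 0 (u⁺ v)) ◂ S
    , (u⁺ , cleared-⊑ wfu a<B B≤sa u⊑s {u⁺} least , wf⁺ , (λ _ → refl) , chain)
    , (λ { zero _ → unused-absent h wfu unused ; (suc j) (s≤s j<n) → free j j<n })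
    , reach-trans reach (done λ { zero v _ → sym (em v) ; (suc j) v _ → refl })
    where open Cleared (clearRow (clear n) h B (m≤m+n B a) a≤e e<B B≤ue wfu c)

  -- w is the highest state, which emits D itself; g is the label of a row.
  record Standard (g : ℕ → ℕ) (d ℓ : Columns) (w : ℕ → State) : Set where
    field
      w-outside : ∀ j v → B ≤ v → B ≤ w j v
      w-label   : ∀ j v → w j v < B → w j v ≡ g v
      w-spread  : ∀ j v b → w j v < B → v ≤ b → b < B → g b ≤ w j v → w j b ≡ w j v
      w-emits   : ∀ j v → ℓ j (w j v) ≡ d j v

  standard-tail : ∀ {g d ℓ w} → Standard g d ℓ w → Standard g (d ∘ suc) (ℓ ∘ suc) (w ∘ suc)
  standard-tail h = record
    { w-outside = w-outside ∘ suc ; w-label = w-label ∘ suc ; w-spread = w-spread ∘ suc ; w-emits = w-emits ∘ suc }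
    where open Standard h

  module Flags (g : ℕ → ℕ) (g-mono : ∀ {x y} → x ≤ y → g x ≤ g y) (g≤ : ∀ v → g v ≤ v) where

    Flagged : State → Set
    Flagged u = ∀ v → v < B → g v ≤ u v

    -- A label below `g v` in row `v` of `u` makes the count of `s` for the threshold `g v` positive
    -- from row `v` on. This gives a row `x ≥ v` with `s x < g v ≤ g x`, against its flag.
    flagged-down : ∀ {u s} → u ⊑ s → Flagged s → Flagged u
    flagged-down {u} {s} u⊑s F v v<B = ≮⇒≥ bad
      where
      bad : ¬ (u v < g v)
      bad lt with #-witness (λ _ → false) (uses s (g v)) v
                    (subst (_< # (uses s (g v)) v) (sym (count-none v (B ∸ v)))
                      (<-≤-trans (subst (0 <_) (sym (trans (#-step (uses u (g v)) v<B)
                                   (cong (λ b → bit b + # (uses u (g v)) (suc v)) (<ᵇ-true lt)))) (s≤s z≤n))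
                        (u⊑s (g v) v (≤-trans (g≤ v) (<⇒≤ v<B)))))
      ... | x , v≤x , x<B , _ , t = <-irrefl refl (<-≤-trans (true-<ᵇ {s x} t) (≤-trans (g-mono v≤x) (F x x<B)))

    flagged-kick : ∀ {a u} → a < B → Flagged u → Flagged (kick a u)
    flagged-kick {a} {u} a<B F v v<B with <-cmp v a
    ... | tri> _ _ a<v = subst (g v ≤_) (sym (kick-below u a<v)) (F v v<B)
    ... | tri≈ _ refl _ = subst (g v ≤_) (sym (kick-at v u)) (≤-trans (F v v<B) (maxTo-upper v u 0 v z≤n ≤-refl))
    ... | tri< v<a _ _ = subst (g v ≤_) (sym (kick-above u v<a))
      (⊓-glb (≤-trans (≤-trans (g-mono (<⇒≤ v<a)) (F a a<B)) (maxTo-upper a u (suc v) a v<a ≤-refl)) (F v v<B))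

    flagged-sortAt : ∀ {r u} → g r ≡ g (suc r) → Flagged u → Flagged (sortAt r u)
    flagged-sortAt {r} {u} gr F v v<B with u r <ᵇ u (suc r) in eq
    ... | false = F v v<B
    ... | true with v ≟ r | v ≟ suc r
    ...   | yes refl | _ = subst (g v ≤_) (sym (exchange-fst u r (suc r))) (≤-trans (F v v<B) (<⇒≤ (true-<ᵇ eq)))
    ...   | no _ | yes refl = subst (g v ≤_) (sym (exchange-snd u (n<1+n r)))
                                (subst (_≤ u r) gr (F r (<-trans (n<1+n r) v<B)))
    ...   | no p | no q = subst (g v ≤_) (sym (exchange-other u r (suc r) v p q)) (F v v<B)

    flagged-exchange : ∀ {u b e} → b < e → e < B → B ≤ u e → g e ≤ u b → Flagged u → Flagged (exchange u b e)
    flagged-exchange {u} {b} {e} b<e e<B B≤ue ge F v v<B with v ≟ b | v ≟ e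
    ... | yes refl | _ = subst (g v ≤_) (sym (exchange-fst u v e)) (≤-trans (g≤ v) (≤-trans (<⇒≤ v<B) B≤ue))
    ... | no _ | yes refl = subst (g v ≤_) (sym (exchange-snd u b<e)) ge
    ... | no p | no q = subst (g v ≤_) (sym (exchange-other u b e v p q)) (F v v<B)

    module _ {d ℓ w u} (st : Standard g d ℓ w) (wfu : WF (w 0) u) where
      open Standard st

      Misplaced : ℕ → Set
      Misplaced v = u v < B × u v ≢ w 0 v

      misplaced? : ∀ v → Dec (Misplaced v)
      misplaced? v = (u v <? B) ×-dec ¬? (u v ≟ w 0 v)

      placed : (∀ v → v < B → ¬ Misplaced v) → (∀ {q} → B ≤ q → ℓ 0 q ≡ false) → ∀ v → ℓ 0 (u v) ≡ d 0 v
      placed none absent v with v <? B | u v <? B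
      ... | no v≮B | _ = trans (absent (outside wfu v (≮⇒≥ v≮B)))
                           (trans (sym (absent (w-outside 0 v (≮⇒≥ v≮B)))) (w-emits 0 v))
      ... | yes v<B | yes uv<B with u v ≟ w 0 v
      ...   | yes e = trans (cong (ℓ 0) e) (w-emits 0 v)
      ...   | no ne = contradiction (uv<B , ne) (none v v<B)
      placed none absent v | yes v<B | no uv≮B with w 0 v <? B
      ...   | no wv≮B = trans (absent (≮⇒≥ uv≮B)) (trans (sym (absent (≮⇒≥ wv≮B))) (w-emits 0 v))
      ...   | yes wv<B = contradiction (labels wfu B ≤-refl)
                (<⇒≢ (#-strict (uses u B) (uses (w 0) B) imp v<B (<ᵇ-false (≮⇒≥ uv≮B)) (<ᵇ-true wv<B) 0 z≤n))
        where
        imp : ∀ x → uses u B x ≡ true → uses (w 0) B x ≡ true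
        imp x t with u x ≟ w 0 x
        ... | yes e = trans (cong (_<ᵇ B) (sym e)) t
        ... | no ne = contradiction (true-<ᵇ {u x} t , ne)
                        (none x (≰⇒> λ B≤x → <-irrefl refl (<-≤-trans (true-<ᵇ {u x} t) (outside wfu x B≤x))))

      target : Flagged u → ∀ {b} → b < B → Misplaced b → (∀ x → b < x → x < B → ¬ Misplaced x)
             → ∃[ e ] (b < e × e < B × B ≤ u e × g e ≤ u b)
      target F {b} b<B (ub<B , ub≢wb) none = found
        where
        p = u b
        same : # (λ x → u x ≡ᵇ p) 0 ≡ # (λ x → w 0 x ≡ᵇ p) 0
        same = +-cancelˡ-≡ (# (uses u p) 0) _ _ (trans (sym (#-split u p 0)) (trans (labels wfu (suc p) ub<B)
                 (trans (#-split (w 0) p 0) (cong (_+ # (λ x → w 0 x ≡ᵇ p) 0) (sym (labels wfu p (<⇒≤ ub<B)))))))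
        absent-above : ∀ x → 0 ≤ x → x < suc b → (w 0 x ≡ᵇ p) ≡ false
        absent-above x _ x≤b = ≡ᵇ-false λ wx≡p → ub≢wb (sym (trans
          (w-spread 0 x b (subst (_< B) (sym wx≡p) ub<B) (≤-pred x≤b) b<B (subst (g b ≤_) (sym wx≡p) (F b b<B))) wx≡p))
        more : # (λ x → u x ≡ᵇ p) (suc b) < # (λ x → w 0 x ≡ᵇ p) (suc b)
        more = begin
          suc (# (λ x → u x ≡ᵇ p) (suc b))   ≡⟨ sym (trans (#-step (λ x → u x ≡ᵇ p) b<B) (cong (λ z → bit z + # (λ x → u x ≡ᵇ p) (suc b)) (≡ᵇ-refl p))) ⟩
          # (λ x → u x ≡ᵇ p) b               ≤⟨ #-antitone (λ x → u x ≡ᵇ p) {0} {b} z≤n ⟩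
          # (λ x → u x ≡ᵇ p) 0               ≡⟨ same ⟩
          # (λ x → w 0 x ≡ᵇ p) 0             ≡⟨ #-skip (λ x → w 0 x ≡ᵇ p) z≤n absent-above ⟩
          # (λ x → w 0 x ≡ᵇ p) (suc b)       ∎
          where open ≤-Reasoning
        found : ∃[ e ] (b < e × e < B × B ≤ u e × g e ≤ u b)
        found with #-witness (λ x → u x ≡ᵇ p) (λ x → w 0 x ≡ᵇ p) (suc b) more
        ... | e , b<e , e<B , f , t = e , b<e , e<B
            , ≮⇒≥ (λ ue<B → none e b<e e<B (ue<B , λ ue≡we → true≢false (trans (sym (trans (cong (_≡ᵇ p) ue≡we) t)) f)))
            , ≤-reflexive (trans (sym (w-label 0 e (subst (_< B) (sym we≡p) ub<B))) we≡p)
          where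
          we≡p : w 0 e ≡ p
          we≡p = true-≡ᵇ t

    -- Induction on columns. In the first one, `climb` repeatedly moves the last misplaced label to
    -- a lower row, which raises the state, until column `d 0` is emitted. The area grows each time
    -- and is at most `B * B`, so the counter cannot run out.
    reach-top : ∀ n {d ℓ w t} → Nested ℓ w → Standard g d ℓ w → Chain n Flagged ℓ w t → Reach n d t
    reach-top zero _ _ _ = done λ _ _ ()
    reach-top (suc n) {d} {ℓ} {w} {t} h st (u₀ , F₀ , wf₀ , em , c₀) =
      reach-trans (climb (suc (B * B)) (m≤m+n (suc (B * B)) (area (uses u₀ B) B)) F₀ wf₀ c₀)
        (done λ { zero v _ → sym (em v) ; (suc j) v _ → refl })
      where
      climb : ∀ k {u T} → B * B < k + area (uses u B) B → Flagged u → WF (w 0) u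
            → Chain n (_⊑ u) (ℓ ∘ suc) (w ∘ suc) T → Reach (suc n) d ((λ v → ℓ 0 (u v)) ◂ T)
      climb zero {u} lt = contradiction (area≤ (uses u B) B) (<⇒≱ lt)
      climb (suc k) {u} {T} lt F wfu c with lastBelow (misplaced? st wfu) B
      ... | inj₂ none = reach-trans (done λ { zero v _ → refl ; (suc j) v _ → refl })
        (reach-◂ (λ v → sym (placed st wfu none (unused-absent h wfu) v))
          (reach-top n (nested-tail h) (standard-tail st)
            (chain-map n (λ {x} x⊑u → flagged-down {x} {u} x⊑u F) c)))
      ... | inj₁ (b , b<B , mis , none) with target st wfu F b<B mis none
      ...   | e₀ , b<e₀ , e₀<B , B≤ue₀ , ge₀ with firstAbove (λ x → B ≤? u x) b<e₀ B≤ue₀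
      ...     | e , b<e , e≤e₀ , B≤ue , full with clear n (nested-tail h) (≤-<-trans e≤e₀ e₀<B) B≤ue c
      ...       | S , chainS , freeS , reachS =
        reach-trans (climb k lt′ F⁺ (WF-exchange u b<e e<B wfu) (chain-raise n {u} {u⁺} u⊑u⁺ chainS))
          (reach-trans (reach-hop h wfu b<e e<B B≤ue mid freeS) (reach-◂ (λ _ → refl) reachS))
        where
        e<B = ≤-<-trans e≤e₀ e₀<B
        ub<B = proj₁ mis
        u⁺ = exchange u b e
        ge : g e ≤ u b
        ge = ≤-trans (g-mono e≤e₀) ge₀
        F⁺ : Flagged u⁺
        F⁺ = flagged-exchange b<e e<B B≤ue ge F
        u⊑u⁺ : u ⊑ u⁺
        u⊑u⁺ = ⊑-exchange u b<e e<B (<⇒≤ (<-≤-trans ub<B B≤ue))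
        grows : # (uses u B) e < # (uses u⁺ B) e
        grows = subst (# (uses u B) e <_)
          (trans (sym (trans (cong (λ b → # (uses u⁺ B) e + bit b) (sym (<ᵇ-false B≤ue))) (Exchange.between u b<e e<B B e b<e ≤-refl)))
            (+-identityʳ _))
          (subst (# (uses u B) e <_) (trans (+-comm 1 _) (cong (λ b → # (uses u B) e + bit b) (sym (<ᵇ-true ub<B)))) (n<1+n _))
        lt′ : B * B < k + area (uses u⁺ B) B
        lt′ = <-≤-trans lt (subst (_≤ k + area (uses u⁺ B) B) (+-suc k _)
                (+-monoʳ-≤ k (area-strict B (λ v → u⊑u⁺ B v ≤-refl) e<B grows)))
        mid : ∀ x → b < x → x < e → ℓ 0 (u b) ≡ true → ℓ 0 (u x) ≡ true
        mid x b<x x<e ℓub = smaller-present h wfu ℓub ux≤ub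
          where
          ux<B : u x < B
          ux<B = ≰⇒> (full x b<x x<e)
          ux≤ub : u x ≤ u b
          ux≤ub with u x ≟ w 0 x
          ... | no ne = contradiction (ux<B , ne) (none x b<x (<-trans x<e e<B))
          ... | yes eq = ≤-trans (≤-reflexive (trans eq (Standard.w-label st 0 x (subst (_< B) eq ux<B))))
                           (≤-trans (g-mono (<⇒≤ x<e)) ge)

-- Diagrams as lists

true-ext : ∀ {a b} → (a ≡ true → b ≡ true) → (b ≡ true → a ≡ true) → a ≡ b
true-ext {true}  {b} f _ = sym (f refl)
true-ext {false} {true}  _ g = g refl
true-ext {false} {false} _ _ = refl

cells : Diagram → Columns
cells T j v = hasCell T v j

∈⇒cell : ∀ {T v j} → (v , j) ∈ T → cells T j v ≡ true
∈⇒cell {_ ∷ T} {v} {j} (here refl) rewrite ≡ᵇ-refl v | ≡ᵇ-refl j = refl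
∈⇒cell {(x , c) ∷ T} {v} {j} (there m) with (x ≡ᵇ v) ∧ (c ≡ᵇ j)
... | true  = refl
... | false = ∈⇒cell {T} m

cell⇒∈ : ∀ {T v j} → cells T j v ≡ true → (v , j) ∈ T
cell⇒∈ {(x , c) ∷ T} {v} {j} e with x ≡ᵇ v in xv | c ≡ᵇ j in cj
... | true  | true  = here (cong₂ _,_ (sym (true-≡ᵇ xv)) (sym (true-≡ᵇ cj)))
... | true  | false = there (cell⇒∈ {T} e)
... | false | _     = there (cell⇒∈ {T} e)

∉⇒cell : ∀ {T v j} → (v , j) ∉ T → cells T j v ≡ false
∉⇒cell {T} {v} {j} m with cells T j v in eq
... | false = refl
... | true  = contradiction (cell⇒∈ {T} eq) m

cell⇒∉ : ∀ {T v j} → cells T j v ≡ false → (v , j) ∉ T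
cell⇒∉ {T} e m = true≢false (trans (sym (∈⇒cell {T} m)) e)

cells-ext : ∀ {T U v j} → ((v , j) ∈ T → (v , j) ∈ U) → ((v , j) ∈ U → (v , j) ∈ T) → cells T j v ≡ cells U j v
cells-ext {T} {U} f g = true-ext (∈⇒cell {U} ∘ f ∘ cell⇒∈ {T}) (∈⇒cell {T} ∘ g ∘ cell⇒∈ {U})

moveCell⁻ : ∀ {T a b c x} → x ∈ moveCell T a b c → (x ∈ T × x ≢ (a , c)) ⊎ x ≡ (b , c)
moveCell⁻ (here e)  = inj₂ e
moveCell⁻ {T} {a} {b} {c} (there m) with ∈-filter⁻ (λ x → ¬? ((proj₁ x ≟ a) ×-dec (proj₂ x ≟ c))) {xs = T} m
... | x∈T , ne = inj₁ (x∈T , λ { refl → ne (refl , refl) })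

moveCell⁺ : ∀ {T a b c x} → (x ∈ T × x ≢ (a , c)) ⊎ x ≡ (b , c) → x ∈ moveCell T a b c
moveCell⁺ (inj₂ e) = here e
moveCell⁺ {T} {a} {b} {c} (inj₁ (x∈T , ne)) =
  there (∈-filter⁺ (λ x → ¬? ((proj₁ x ≟ a) ×-dec (proj₂ x ≟ c))) x∈T λ { (refl , refl) → ne refl })

InCols : ℕ → Diagram → Set
InCols n T = ∀ {v j} → (v , j) ∈ T → j < n

kohnert⇒move : ∀ {n T U} → InCols n T → KohnertMove T U → Move n (cells T) (cells U)
kohnert⇒move {n} {T} {U} inT (a , c , b , m , right , b<a , b∉ , mid , iff) = record
  { col = c ; from = a ; to = b ; col<n = inT m
  ; filled = ∈⇒cell {T} m
  ; rightmost = λ j c<j _ → ∉⇒cell {T} λ m′ → contradiction (right j m′) (<⇒≱ c<j)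
  ; to<from = b<a
  ; empty = ∉⇒cell {T} b∉
  ; jumped = λ v p q → ∈⇒cell {T} (mid v p q)
  ; left = ∉⇒cell {U} λ m′ → gone (to (iff (a , c)) m′)
  ; arrived = ∈⇒cell {U} (from (iff (b , c)) (inj₂ refl))
  ; otherRows = λ v p q → same (λ { refl → p refl }) (λ { refl → q refl })
  ; otherCols = λ j v _ p → same (λ { refl → p refl }) (λ { refl → p refl }) }
  where
  open Equivalence
  gone : ¬ (((a , c) ∈ T × (a , c) ≢ (a , c)) ⊎ (a , c) ≡ (b , c))
  gone (inj₁ (_ , ne)) = ne refl
  gone (inj₂ refl)     = <-irrefl refl b<a
  same : ∀ {v j} → (v , j) ≢ (a , c) → (v , j) ≢ (b , c) → cells U j v ≡ cells T j v
  same {v} {j} p q = cells-ext {U} {T} fwd λ m′ → from (iff (v , j)) (inj₁ (m′ , p))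
    where
    fwd : (v , j) ∈ U → (v , j) ∈ T
    fwd m′ with to (iff (v , j)) m′
    ... | inj₁ (m″ , _) = m″
    ... | inj₂ e = contradiction e q

kohnert-InCols : ∀ {n T U} → InCols n T → KohnertMove T U → InCols n U
kohnert-InCols inT (a , c , b , m , _ , _ , _ , _ , iff) {v} {j} m′ with Equivalence.to (iff (v , j)) m′
... | inj₁ (m″ , _) = inT m″
... | inj₂ refl     = inT m

moveCell-InCols : ∀ {n T a b c} → InCols n T → c < n → InCols n (moveCell T a b c)
moveCell-InCols {T = T} inT c<n m with moveCell⁻ {T} m
... | inj₁ (m′ , _) = inT m′
... | inj₂ refl     = c<n

move⇒kohnert : ∀ {n T s t} → InCols n T → Agree n (cells T) s → (m : Move n s t)
  → let open Move m in KohnertMove T (moveCell T from to col) × Agree n (cells (moveCell T from to col)) t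
move⇒kohnert {n} {T} {s} {t} inT T≈s m =
  (from , col , to , cell⇒∈ {T} (trans (T≈s _ _ col<n) filled) , right , to<from
    , cell⇒∉ {T} (trans (T≈s _ _ col<n) empty)
    , (λ v p q → cell⇒∈ {T} (trans (T≈s _ v col<n) (jumped v p q)))
    , λ x → mk⇔ (moveCell⁻ {T}) (moveCell⁺ {T}))
  , agree
  where
  open Move m
  U = moveCell T from to col
  right : ∀ j → (from , j) ∈ T → j ≤ col
  right j m′ = ≮⇒≥ λ c<j → cell⇒∉ {T} (trans (T≈s j _ (inT m′)) (rightmost j c<j (inT m′))) m′
  same : ∀ {v j} → (v , j) ≢ (from , col) → (v , j) ≢ (to , col) → cells U j v ≡ cells T j v
  same p q = cells-ext {U} {T} fwd λ m′ → moveCell⁺ {T} (inj₁ (m′ , p))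
    where
    fwd : _ → _
    fwd m′ with moveCell⁻ {T} m′
    ... | inj₁ (m″ , _) = m″
    ... | inj₂ e = contradiction e q
  gone : (from , col) ∉ U
  gone m′ with moveCell⁻ {T} m′
  ... | inj₁ (_ , ne) = ne refl
  ... | inj₂ e = <⇒≢ to<from (sym (proj₁ (,-injective e)))
  agree : Agree n (cells U) t
  agree j v j<n with j ≟ col
  ... | no j≢c = trans (same (λ { refl → j≢c refl }) (λ { refl → j≢c refl }))
                   (trans (T≈s j v j<n) (sym (otherCols j v j<n j≢c)))
  ... | yes refl with v ≟ from | v ≟ to
  ...   | yes refl | _ = trans (∉⇒cell {U} gone) (sym left)
  ...   | no _ | yes refl = trans (∈⇒cell {U} (here refl)) (sym arrived)
  ...   | no p | no q = trans (same (λ { refl → p refl }) (λ { refl → q refl }))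
                          (trans (T≈s j v j<n) (sym (otherRows v p q)))

reach⇒star : ∀ {n s t} → Reach n s t → ∀ T → InCols n T → Agree n (cells T) s
  → ∃[ U ] (Star KohnertMove T U × InCols n U × Agree n (cells U) t)
reach⇒star (done s≈t) T inT T≈s = T , ε , inT , λ j v j<n → trans (T≈s j v j<n) (s≈t j v j<n)
reach⇒star (step m p) T inT T≈s with move⇒kohnert {T = T} inT T≈s m
... | k , agree with reach⇒star p _ (moveCell-InCols {T = T} inT (Move.col<n m)) agree
...   | U , path , rest = U , k ◅ path , rest

agree⇒≃ : ∀ {n T U} → InCols n T → InCols n U → Agree n (cells T) (cells U) → T ≃ U
agree⇒≃ {T = T} {U} inT inU a (v , j) = mk⇔
  (λ m → cell⇒∈ {U} (trans (sym (a j v (inT m))) (∈⇒cell {T} m)))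
  (λ m → cell⇒∈ {T} (trans (a j v (inU m)) (∈⇒cell {U} m)))

-- The scan of the pairing rule

-- A column is neutral when it has both or none of the rows r, r + 1.
-- Ready holds at a column before which every cell of row r is paired with a
-- cell of row r + 1: the last column that is not neutral has only row r + 1.
Ready : ℕ → Columns → ℕ → Set
Ready r t k = (∀ j → j < k → t j r ≡ t j (suc r))
            ⊎ ∃[ i ] (i < k × t i r ≡ false × t i (suc r) ≡ true × (∀ j → i < j → j < k → t j r ≡ t j (suc r)))

ready-neutral : ∀ {r t k} → t k r ≡ t k (suc r) → Ready r t k → Ready r t (suc k)
ready-neutral {r} {t} {k} e (inj₁ h) = inj₁ λ j j≤k → extend j j≤k
  where
  extend : ∀ j → j < suc k → t j r ≡ t j (suc r)
  extend j j≤k with m≤n⇒m<n∨m≡n (≤-pred j≤k)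
  ... | inj₁ j<k  = h j j<k
  ... | inj₂ refl = e
ready-neutral {r} {t} {k} e (inj₂ (i , i<k , p , q , h)) = inj₂ (i , m<n⇒m<1+n i<k , p , q , extend)
  where
  extend : ∀ j → i < j → j < suc k → t j r ≡ t j (suc r)
  extend j i<j j≤k with m≤n⇒m<n∨m≡n (≤-pred j≤k)
  ... | inj₁ j<k  = h j i<j j<k
  ... | inj₂ refl = e

ready-after : ∀ {r t k} → t k r ≡ false → t k (suc r) ≡ true → Ready r t (suc k)
ready-after {k = k} p q = inj₂ (k , n<1+n k , p , q , λ j k<j j≤k → contradiction k<j (≤⇒≯ (≤-pred j≤k)))

ready-agree : ∀ {r s t k} → (∀ j v → j < k → s j v ≡ t j v) → Ready r s k → Ready r t k
ready-agree a (inj₁ h) = inj₁ λ j j<k → trans (sym (a j _ j<k)) (trans (h j j<k) (a j _ j<k))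
ready-agree a (inj₂ (i , i<k , p , q , h)) =
  inj₂ (i , i<k , trans (sym (a i _ i<k)) p , trans (sym (a i _ i<k)) q
       , λ j i<j j<k → trans (sym (a j _ j<k)) (trans (h j i<j j<k) (a j _ j<k)))

module Pairing (T : Diagram) (r : ℕ) where

  t : Columns
  t = cells T

  -- `Ready` holds whenever the stack is empty, and both kinds of cells moved by the operators are
  -- met at such a moment: the leftmost unpaired cell of row `r` is the bottom of the stack, and a
  -- cell of row `suc r` stays unpaired only if it finds the stack empty.
  record Paired (k : ℕ) (st lo : List ℕ) : Set where
    field
      whenEmpty : st ≡ [] → Ready r t k
      bottom    : ∀ c → last st ≡ just c → t c r ≡ true × t c (suc r) ≡ false × Ready r t c
      unmatched : ∀ c → c ∈ lo → t c r ≡ false × t c (suc r) ≡ true × Ready r t c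

  paired-step : ∀ {k st lo} → Paired k st lo
              → let S = pairStep T r (st , lo) k in Paired (suc k) (proj₁ S) (proj₂ S)
  paired-step {k} {st} {lo} h with hasCell T r k in up | hasCell T (suc r) k in low
  ... | true | true = record { whenEmpty = ready-neutral {r} {t} {k} (trans up (sym low)) ∘ whenEmpty ; bottom = bottom ; unmatched = unmatched }
    where open Paired h
  ... | false | false = record { whenEmpty = ready-neutral {r} {t} {k} (trans up (sym low)) ∘ whenEmpty ; bottom = bottom ; unmatched = unmatched }
    where open Paired h
  ... | true | false = record { whenEmpty = λ () ; bottom = bottom′ st refl ; unmatched = unmatched }
    where
    open Paired h
    bottom′ : ∀ xs → xs ≡ st → ∀ c → last (k ∷ xs) ≡ just c → t c r ≡ true × t c (suc r) ≡ false × Ready r t c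
    bottom′ []       e c refl = up , low , whenEmpty (sym e)
    bottom′ (x ∷ xs) e c l    = bottom c (trans (cong last (sym e)) l)
  paired-step {k} {[]} {lo} h | false | true = record
    { whenEmpty = λ _ → ready-after {r} {t} {k} up low ; bottom = λ _ ()
    ; unmatched = λ { c (here refl) → up , low , whenEmpty refl ; c (there m) → unmatched c m } }
    where open Paired h
  paired-step {k} {x ∷ st} {lo} h | false | true = record
    -- Column `k` has only the cell in row `suc r`, so it serves itself as the last column that is
    -- not neutral, whatever came before.
    { whenEmpty = λ _ → ready-after {r} {t} {k} up low ; bottom = bottom′ st refl ; unmatched = unmatched }
    where
    open Paired h
    bottom′ : ∀ xs → xs ≡ st → ∀ c → last xs ≡ just c → t c r ≡ true × t c (suc r) ≡ false × Ready r t c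
    bottom′ (y ∷ ys) e c l = bottom c (trans (cong (λ zs → last (x ∷ zs)) (sym e)) l)

  scan : ℕ → List ℕ × List ℕ
  scan k = foldl (pairStep T r) ([] , []) (upTo k)

  scan-suc : ∀ k → scan (suc k) ≡ pairStep T r (scan k) k
  scan-suc k = trans (cong (foldl (pairStep T r) ([] , [])) (sym (upTo-∷ʳ k))) (foldl-∷ʳ (pairStep T r) ([] , []) k (upTo k))

  paired : ∀ k → Paired k (proj₁ (scan k)) (proj₂ (scan k))
  paired zero    = record { whenEmpty = λ _ → inj₁ (λ _ ()) ; bottom = λ _ () ; unmatched = λ _ () }
  paired (suc k) = subst (λ S → Paired (suc k) (proj₁ S) (proj₂ S)) (sym (scan-suc k)) (paired-step (paired k))

  open Paired (paired (colBound T)) public using (bottom; unmatched)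

-- The labels of the given diagram, and the theorem

bounds : ∀ (D : Diagram) → ∃[ n ] (∀ {v j} → (v , j) ∈ D → v < n × j < n)
bounds [] = 0 , λ ()
bounds ((x , c) ∷ D) with bounds D
... | n , h = suc (x ⊔ c ⊔ n) , λ
  { (here refl) → s≤s (≤-trans (m≤m⊔n x c) (m≤m⊔n _ n)) , s≤s (≤-trans (m≤n⊔m x c) (m≤m⊔n _ n))
  ; (there m) → <-≤-trans (proj₁ (h m)) (m≤n⇒m≤1+n (m≤n⊔m (x ⊔ c) n))
              , <-≤-trans (proj₂ (h m)) (m≤n⇒m≤1+n (m≤n⊔m (x ⊔ c) n)) }

-- Since D has no cell in row r without one below it, a single label for rows r and
-- r + 1 suffices; it makes the bound on the first state invariant under sortAt r.
merge : ℕ → ℕ → ℕ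
merge r v = if v ≡ᵇ suc r then r else v

module Merge (r : ℕ) where

  g : ℕ → ℕ
  g = merge r

  g-lower : g (suc r) ≡ r
  g-lower rewrite ≡ᵇ-refl (suc r) = refl

  g-other : ∀ {v} → v ≢ suc r → g v ≡ v
  g-other p rewrite ≡ᵇ-false p = refl

  g-upper : g r ≡ r
  g-upper = g-other (<⇒≢ (n<1+n r))

  g≤ : ∀ v → g v ≤ v
  g≤ v with v ≟ suc r
  ... | yes refl = subst (_≤ suc r) (sym g-lower) (n≤1+n r)
  ... | no p     = ≤-reflexive (g-other p)

  g-mono : ∀ {x y} → x ≤ y → g x ≤ g y
  g-mono {x} {y} x≤y with y ≟ suc r
  ... | no q     = subst (g x ≤_) (sym (g-other q)) (≤-trans (g≤ x) x≤y)
  ... | yes refl with x ≟ suc r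
  ...   | yes refl = ≤-refl
  ...   | no p     = subst₂ _≤_ (sym (g-other p)) (sym g-lower) (≤-pred (≤∧≢⇒< x≤y p))

  g-drop : ∀ {v x} → v < x → g x ≤ g v → v ≡ r × x ≡ suc r
  g-drop {v} {x} v<x gx≤gv with x ≟ suc r
  ... | no p = contradiction v<x (≤⇒≯ (subst (_≤ v) (g-other p) (≤-trans gx≤gv (g≤ v))))
  ... | yes refl = ≤-antisym (≤-pred v<x) (subst₂ _≤_ g-lower (g-other (<⇒≢ v<x)) gx≤gv) , refl

module Main (D : Diagram) (nw : Northwest D) (r : ℕ) (r⊆r+1 : ∀ c → (r , c) ∈ D → (suc r , c) ∈ D) where

  open Merge r

  n : ℕ
  n = proj₁ (bounds D)

  B : ℕ
  -- Rows `r` and `suc r` may lie beyond every cell of `D`, yet states must be able to exchange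
  -- their labels, so the bound is pushed past both.
  B = n ⊔ suc (suc r)

  open Rows B
  open States B
  open Chains B
  open Reaching B
  open Flags g g-mono g≤
  open Lowering {r} (m≤n⊔m n (suc (suc r)))

  r+1<B : suc r < B
  r+1<B = m≤n⊔m n (suc (suc r))

  r<B : r < B
  r<B = <-trans (n<1+n r) r+1<B

  row<B : ∀ {v j} → (v , j) ∈ D → v < B
  row<B m = <-≤-trans (proj₁ (proj₂ (bounds D) m)) (m≤m⊔n n _)

  d : Columns
  d = cells D

  Live : ℕ → ℕ → Set
  Live j v = ∃[ c ] (j ≤ c × (v , c) ∈ D)

  live? : ∀ j v → Dec (Live j v)
  live? j v = map′ to from (any? (λ x → (proj₁ x ≟ v) ×-dec (j ≤? proj₂ x)) D)
    where
    to : Any (λ x → proj₁ x ≡ v × j ≤ proj₂ x) D → Live j v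
    to a with find a
    ... | (x , c) , m , refl , j≤c = c , j≤c , m
    from : Live j v → Any (λ x → proj₁ x ≡ v × j ≤ proj₂ x) D
    from (c , j≤c , m) = lose m (refl , j≤c)

  w : ℕ → State
  w j v with live? j v
  ... | yes _ = g v
  ... | no  _ = B

  -- The shared label `r` reads row `suc r`, which has a cell wherever row `r` does; the label
  -- `suc r` never occurs.
  ℓ : Columns
  ℓ j q = if q ≡ᵇ r then d j (suc r) else if q ≡ᵇ suc r then false else d j q

  w-live : ∀ {j v} → Live j v → w j v ≡ g v
  w-live {j} {v} a with live? j v
  ... | yes _ = refl
  ... | no ¬a = contradiction a ¬a

  w-dead : ∀ {j v} → ¬ Live j v → w j v ≡ B
  w-dead {j} {v} ¬a with live? j v
  ... | yes a = contradiction a ¬a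
  ... | no _  = refl

  w<B⇒live : ∀ {j v} → w j v < B → Live j v
  w<B⇒live {j} {v} lt with live? j v
  ... | yes a = a
  ... | no _  = contradiction lt (<-irrefl refl)

  ℓ-r : ∀ j → ℓ j r ≡ d j (suc r)
  ℓ-r j rewrite ≡ᵇ-refl r = refl

  ℓ-other : ∀ j {q} → q ≢ r → q ≢ suc r → ℓ j q ≡ d j q
  ℓ-other j p q rewrite ≡ᵇ-false p | ≡ᵇ-false q = refl

  ℓ-r+1 : ∀ j → ℓ j (suc r) ≡ false
  ℓ-r+1 j rewrite ≡ᵇ-false (>⇒≢ (n<1+n r)) | ≡ᵇ-refl (suc r) = refl

  -- The northwest condition with rows compared by label. The one new case, row `suc r` against row
  -- `r`, is the hypothesis `r⊆r+1`.
  northwest-≤ : ∀ {j c v x} → (v , j) ∈ D → (x , c) ∈ D → j ≤ c → g x ≤ g v → (x , j) ∈ D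
  northwest-≤ {j} {c} {v} {x} vj xc j≤c gx≤gv with m≤n⇒m<n∨m≡n j≤c | <-cmp x v
  ... | inj₂ refl | _ = xc
  ... | inj₁ j<c | tri< x<v _ _ = nw x v j c vj xc x<v j<c
  ... | inj₁ _ | tri≈ _ refl _ = vj
  ... | inj₁ _ | tri> _ _ v<x with g-drop v<x gx≤gv
  ...   | refl , refl = r⊆r+1 j vj

  w-emits : ∀ j v → ℓ j (w j v) ≡ d j v
  w-emits j v with live? j v
  ... | no ¬a = trans (ℓ-other j (>⇒≢ r<B) (>⇒≢ r+1<B))
                  (trans (∉⇒cell {D} λ m → <-irrefl refl (row<B m)) (sym (∉⇒cell {D} λ m → ¬a (j , ≤-refl , m))))
  ... | yes (c , j≤c , m) with v ≟ r | v ≟ suc r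
  -- Row `r` has a cell in some column `c ≥ j`, so a cell of row `suc r` in column `j` yields one of
  -- row `r` by the northwest condition.
  ...   | yes refl | _ = trans (cong (ℓ j) g-upper) (trans (ℓ-r j) (true-ext
            (λ e → ∈⇒cell {D} (northwest-≤ (cell⇒∈ {D} e) m j≤c (≤-reflexive (trans g-upper (sym g-lower)))))
            (λ e → ∈⇒cell {D} (r⊆r+1 j (cell⇒∈ {D} e)))))
  ...   | no _ | yes refl = trans (cong (ℓ j) g-lower) (ℓ-r j)
  ...   | no p | no q = trans (cong (ℓ j) (g-other q)) (ℓ-other j p q)

  standard : Standard g d ℓ w
  standard = record
    { w-outside = λ j v B≤v → ≤-reflexive (sym (w-dead λ { (c , _ , m) → <-irrefl refl (<-≤-trans (row<B m) B≤v) }))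
    ; w-label = λ j v lt → w-live (w<B⇒live lt)
    ; w-spread = spread
    ; w-emits = w-emits }
    where
    spread : ∀ j v b → w j v < B → v ≤ b → b < B → g b ≤ w j v → w j b ≡ w j v
    spread j v b lt v≤b b<B gb≤ with m≤n⇒m<n∨m≡n v≤b
    ... | inj₂ refl = refl
    ... | inj₁ v<b with w<B⇒live lt
    ...   | c , j≤c , m with g-drop v<b (subst (g b ≤_) (w-live (c , j≤c , m)) gb≤)
    ...     | refl , refl = trans (w-live (c , j≤c , r⊆r+1 c m))
                              (trans g-lower (sym (trans (w-live (c , j≤c , m)) g-upper)))

  nested : Nested ℓ w
  nested = record { bounded = λ j q e → let v , m , e′ = label j q e in subst (_< B) e′ (≤-<-trans (g≤ v) (row<B m))
                  ; closed = closed }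
    where
    label : ∀ j q → ℓ j q ≡ true → ∃[ v ] ((v , j) ∈ D × g v ≡ q)
    label j q e with q ≟ r | q ≟ suc r
    ... | yes refl | _ = suc r , cell⇒∈ {D} (trans (sym (ℓ-r j)) e) , g-lower
    ... | no _ | yes refl = contradiction (trans (sym e) (ℓ-r+1 j)) true≢false
    ... | no p | no p′ = q , cell⇒∈ {D} (trans (sym (ℓ-other j p p′)) e) , g-other p′
    closed : ∀ j p x → ℓ j p ≡ true → w j x ≤ p → ℓ j (w j x) ≡ true
    closed j p x e wx≤p with label j p e
    ... | v , m , refl with w<B⇒live {j} {x} (≤-<-trans wx≤p (≤-<-trans (g≤ v) (row<B m)))
    ...   | c , j≤c , m′ = trans (w-emits j x)
              (∈⇒cell {D} (northwest-≤ m m′ j≤c (subst (_≤ g v) (w-live (c , j≤c , m′)) wx≤p)))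

  w-weaken : ∀ j → w (suc j) ⊑ w j
  w-weaken j p v p≤B = #-mono (uses (w (suc j)) p) (uses (w j) p) v λ x _ _ e → <ᵇ-true (later x (true-<ᵇ {w (suc j) x} e))
    where
    later : ∀ x → w (suc j) x < p → w j x < p
    later x lt with w<B⇒live {suc j} {x} (<-≤-trans lt p≤B)
    ... | c , j<c , m = subst (_< p) (trans (w-live (c , j<c , m)) (sym (w-live (c , <⇒≤ j<c , m)))) lt

  -- The states `w j` themselves form the chain: forgetting labels is a lowering.
  chain-top : ∀ k {P d ℓ w} → Standard g d ℓ w → (∀ j → w (suc j) ⊑ w j) → P (w 0) → Chain k P ℓ w d
  chain-top zero    _ _ _ = tt
  chain-top (suc k) {w = w} st weaken Pw = w 0 , Pw , wf (Standard.w-outside st 0) (λ _ _ → refl)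
    , (λ v → sym (Standard.w-emits st 0 v)) , chain-top k (standard-tail st) (weaken ∘ suc) (weaken 0)

  chain-D : Chain n Flagged ℓ w d
  chain-D = chain-top n standard w-weaken flagged
    where
    flagged : Flagged (w 0)
    flagged v v<B with live? 0 v
    ... | yes _ = ≤-refl
    ... | no _  = ≤-trans (g≤ v) (<⇒≤ v<B)

  -- Admissibility of a list of cells. A chain sees only the first `n` columns, so `InCols` excludes
  -- cells further right.
  KD′ : Diagram → Set
  KD′ T = InCols n T × Chain n Flagged ℓ w (cells T)

  star⇒KD′ : ∀ {T U} → Star KohnertMove T U → KD′ T → KD′ U
  star⇒KD′ ε h = h
  star⇒KD′ {T} (_◅_ {j = T₁} m p) (inT , c) = star⇒KD′ p
    (kohnert-InCols {T = T} {T₁} inT m , chain-move n nested flagged-kick (kohnert⇒move {T = T} {T₁} inT m) c)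

  KD⇒KD′ : ∀ {T} → KD D T → KD′ T
  KD⇒KD′ {T} (T′ , path , eq) with star⇒KD′ path ((λ m → proj₂ (proj₂ (bounds D) m)) , chain-D)
  ... | inT′ , c = (λ m → inT′ (Equivalence.from (eq _) m))
    , chain-agree n (λ j v _ → cells-ext {T′} {T} (Equivalence.to (eq (v , j))) (Equivalence.from (eq (v , j)))) c

  KD′⇒KD : ∀ {T} → KD′ T → KD D T
  KD′⇒KD {T} (inT , c) with reach⇒star (reach-top n nested standard c) D (λ m → proj₂ (proj₂ (bounds D) m)) (λ _ _ _ → refl)
  ... | U , path , inU , agree = U , path , agree⇒≃ {T = U} {T} inU inT agree

  KD-lowered : ∀ {T U c} → KD D T → InCols n U → Ready r (cells T) c → Lowered n c (cells T) (cells U) → KD D U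
  KD-lowered {T} {U} {c} h inU ready m with KD⇒KD′ h | ready
  ... | _ , ch | inj₁ neutral = KD′⇒KD (inU , chain-lower-neutral n c nested (flagged-sortAt (trans g-upper (sym g-lower))) neutral m ch)
  ... | _ , ch | inj₂ (i , i<c , p , q , neutral) =
    KD′⇒KD (inU , chain-lower-after n i c nested i<c p q neutral m ch)

  moved-other : ∀ {T a b c v j} → (v , j) ≢ (a , c) → (v , j) ≢ (b , c) → cells (moveCell T a b c) j v ≡ cells T j v
  moved-other {T} {a} {b} {c} {v} {j} p q = cells-ext {moveCell T a b c} {T} fwd λ m → moveCell⁺ {T} (inj₁ (m , p))
    where
    fwd : (v , j) ∈ moveCell T a b c → (v , j) ∈ T
    fwd m with moveCell⁻ {T} m
    ... | inj₁ (m′ , _) = m′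
    ... | inj₂ e = contradiction e q

  moved-gone : ∀ {T a b c} → a ≢ b → cells (moveCell T a b c) c a ≡ false
  moved-gone {T} {a} {b} {c} a≢b = ∉⇒cell {moveCell T a b c} gone
    where
    gone : (a , c) ∉ moveCell T a b c
    gone m with moveCell⁻ {T} m
    ... | inj₁ (_ , ne) = ne refl
    ... | inj₂ e = a≢b (proj₁ (,-injective e))

  KD-lower : ∀ {T T′} → KD D T → lower r T ≡ just T′ → KD D T′
  KD-lower {T} {T′} h e with last (unpairedUpper T r) in eq
  KD-lower {T} {T′} h refl | just c with Pairing.bottom T r c eq
  ... | up , low , ready = KD-lowered h (moveCell-InCols {T = T} inT c<n) ready record
    { c<n = c<n ; source = up ; target = low
    ; source′ = moved-gone {T} {r} {suc r} {c} (<⇒≢ (n<1+n r)) ; target′ = ∈⇒cell {moveCell T r (suc r) c} (here refl)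
    ; otherRows = λ v p q → moved-other {T} {r} {suc r} {c} (λ { refl → p refl }) (λ { refl → q refl })
    ; otherCols = λ j v _ p → moved-other {T} {r} {suc r} {c} (λ { refl → p refl }) (λ { refl → p refl }) }
    where
    inT : InCols n T
    inT = proj₁ (KD⇒KD′ h)
    c<n : c < n
    c<n = inT (cell⇒∈ {T} up)

  -- Undoing `raise` lowers the cell of column `c` from row `r` again. The columns before `c` are
  -- the same in both diagrams, so readiness carries over and `KD-lowered` applies.
  KD-unraise : ∀ {U U′} → raise r U ≡ just U′ → KD D U′ → KD D U
  KD-unraise {U} e h with unpairedLower U r in eq
  KD-unraise {U} refl h | c ∷ _ with Pairing.unmatched U r c (subst (c ∈_) (sym eq) (here refl))
  ... | up , low , ready = KD-lowered h inU
    (ready-agree {r} {cells U} {cells U′} {c} (λ j v j<c → sym (moved-other {U} {suc r} {r} {c} (λ { refl → <-irrefl refl j<c }) (λ { refl → <-irrefl refl j<c }))) ready)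
    record
    { c<n = c<n ; source = ∈⇒cell {U′} (here refl) ; target = moved-gone {U} {suc r} {r} {c} (>⇒≢ (n<1+n r))
    ; source′ = up ; target′ = low
    ; otherRows = λ v p q → sym (moved-other {U} {suc r} {r} {c} (λ { refl → q refl }) (λ { refl → p refl }))
    ; otherCols = λ j v _ p → sym (moved-other {U} {suc r} {r} {c} (λ { refl → p refl }) (λ { refl → p refl })) }
    where
    U′ = moveCell U (suc r) r c
    inU′ : InCols n U′
    inU′ = proj₁ (KD⇒KD′ h)
    c<n : c < n
    c<n = inU′ (here refl)
    inU : InCols n U
    inU {v} {j} m with j ≟ c
    ... | yes refl = c<n
    ... | no p = inU′ (moveCell⁺ {U} (inj₁ (m , λ { refl → p refl })))

  𝔇⇒KD : ∀ k {U V} → raiseIter r k U ≡ just V → KD D V → KD D U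
  𝔇⇒KD zero    refl h = h
  𝔇⇒KD (suc k) {U} e h with raise r U in eq
  ... | just U′ = KD-unraise {U} {U′} eq (𝔇⇒KD k {U′} e h)

theorem4p11 : (D : Diagram) → Northwest D → (r : ℕ)
    → (∀ c → (r , c) ∈ D → (suc r , c) ∈ D)
    → (∀ T T' → KD D T → lower r T ≡ just T' → KD D T')
    × (∀ U → 𝔇 r (KD D) U ⇔ KD D U)
theorem4p11 D nw r r⊆r+1 = (λ T T′ → KD-lower {T} {T′})
  , λ U → mk⇔ (λ (k , V , e , h) → 𝔇⇒KD k {U} {V} e h) (λ h → 0 , U , refl , h)
  where open Main D nw r r⊆r+1
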